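{- \textsc{Bicolored $P_3$ Deletion} admits a problem kernel with $\mathcal{O}(k\Delta\min(k,\Delta))$ vertices that can be computed in $\mathcal{O}(nm)$ time, where $\Delta$ is the maximum degree of $G$, $n=|V|$ and $m=|E|$.
   Context: A two-colored graph $G=(V,E_r,E_b)$ is a finite simple undirected graph whose edge set $E=E_r\uplus E_b$ is partitioned into red and blue edges. A bicolored $P_3$ is an induced subgraph on three vertices $u,v,w$ with edges $\{u,v\},\{v,w\}$ of different colors and $\{u,w\}\notin E$. \textsc{Bicolored $P_3$ Deletion}: given $G$ and an integer $k\in\mathbb{N}$, decide whether some $S\subseteq E$ with $|S|\le k$ makes $G-S$ free of induced bicolored $P_3$s. A problem kernel of the stated size is an algorithm that maps any instance $(G,k)$ to an instance $(G',k')$ of the same problem with $k'\le k$, such that $(G,k)$ is a yes-instance if and only if $(G',k')$ is, and $G'$ has $\mathcal{O}(k\Delta\min(k,\Delta))$ vertices. -}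

module Defs where

open import Data.Bool using (Bool; true; false; T; not; _∧_; _∨_; if_then_else_)
open import Data.Bool.Properties using (T?)
open import Data.Fin using (Fin; toℕ; _<_)
open import Data.Fin.Properties using (_<?_)
open import Data.Fin.Subset using (Subset; ∣_∣)
open import Data.List using (List; length; lookup; map; filter; allFin; cartesianProduct)
open import Data.List.Extrema.Nat using (max)
open import Data.List.Membership.Propositional using (_∈_)
open import Data.List.Relation.Unary.Unique.Propositional using (Unique)
open import Data.Nat using (ℕ; _+_; _∸_; _≤_; _≟_)
open import Data.Product using (_×_; _,_; ∃-syntax)
open import Data.Vec using (tabulate)
open import Function.Bundles using (_⇔_)
open import Relation.Binary.PropositionalEquality using (_≡_; _≢_; cong; cong₂)
open import Relation.Nullary using (¬_)
open import Relation.Nullary.Decidable using (⌊_⌋; _×-dec_)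

------------------------------------------------------------------------
-- Two-coloured graphs

-- A set of unordered pairs of distinct elements of Fin n.
record EdgeSet (n : ℕ) : Set where
  field
    has       : Fin n → Fin n → Bool
    symmetric : ∀ u v → has u v ≡ has v u
    loopless  : ∀ u → has u u ≡ false

  _∋_─_ : Fin n → Fin n → Set
  _∋_─_ u v = T (has u v)

  -- Each unordered pair {u , v} is listed once, as (u , v) with u < v.
  pairs : List (Fin n × Fin n)
  pairs = filter (λ (u , v) → (u <? v) ×-dec T? (has u v))
                 (cartesianProduct (allFin n) (allFin n))

  card : ℕ
  card = length pairs

open EdgeSet public

infix 4 _⊆ᴱ_
infixl 6 _∪ᴱ_ _∖ᴱ_

_⊆ᴱ_ : ∀ {n} → EdgeSet n → EdgeSet n → Set
A ⊆ᴱ B = ∀ u v → A ∋ u ─ v → B ∋ u ─ v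

_∪ᴱ_ : ∀ {n} → EdgeSet n → EdgeSet n → EdgeSet n
A ∪ᴱ B = record
  { has       = λ u v → has A u v ∨ has B u v
  ; symmetric = λ u v → cong₂ _∨_ (symmetric A u v) (symmetric B u v)
  ; loopless  = λ u → cong₂ _∨_ (loopless A u) (loopless B u)
  }

_∖ᴱ_ : ∀ {n} → EdgeSet n → EdgeSet n → EdgeSet n
A ∖ᴱ B = record
  { has       = λ u v → has A u v ∧ not (has B u v)
  ; symmetric = λ u v → cong₂ (λ a b → a ∧ not b) (symmetric A u v) (symmetric B u v)
  ; loopless  = λ u → cong (_∧ not (has B u u)) (loopless A u)
  }

data Color : Set where
  red blue : Color

-- The vertex set is Fin order.
record TwoColoredGraph : Set where
  field
    order    : ℕ
    Eᵣ Eᵇ    : EdgeSet order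
    disjoint : ∀ u v → Eᵣ ∋ u ─ v → ¬ (Eᵇ ∋ u ─ v)

  Vertex : Set
  Vertex = Fin order

  E : EdgeSet order
  E = Eᵣ ∪ᴱ Eᵇ

  E[_] : Color → EdgeSet order
  E[ red  ] = Eᵣ
  E[ blue ] = Eᵇ

  size : ℕ
  size = card E

  neighbours : Vertex → Subset order
  neighbours v = tabulate (has E v)

  degree : Vertex → ℕ
  degree v = ∣ neighbours v ∣

  -- Δ is 0 for the graph without vertices.
  Δ : ℕ
  Δ = max 0 (map degree (allFin order))

  -- u, v and w are automatically distinct. Taking the first edge red is no
  -- restriction, since u and w are interchangeable.
  BicoloredP₃ : Vertex → Vertex → Vertex → Set
  BicoloredP₃ u v w = Eᵣ ∋ u ─ v × Eᵇ ∋ v ─ w × ¬ (E ∋ u ─ w)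

  BicoloredP₃-Free : Set
  BicoloredP₃-Free = ∀ u v w → ¬ BicoloredP₃ u v w

open TwoColoredGraph public

infixl 6 _─_

_─_ : (G : TwoColoredGraph) → EdgeSet (order G) → TwoColoredGraph
G ─ S = record
  { order    = order G
  ; Eᵣ       = Eᵣ G ∖ᴱ S
  ; Eᵇ       = Eᵇ G ∖ᴱ S
  ; disjoint = λ u v r b → disjoint G u v (∧-fst (has (Eᵣ G) u v) r) (∧-fst (has (Eᵇ G) u v) b)
  }
  where
  ∧-fst : ∀ a {b} → T (a ∧ b) → T a
  ∧-fst true _ = _

------------------------------------------------------------------------
-- Bicolored P₃ Deletion

record Instance : Set where
  constructor ⟨_,_⟩
  field
    graph  : TwoColoredGraph
    budget : ℕ

open Instance public

YesInstance : Instance → Set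
YesInstance ⟨ G , k ⟩ =
  ∃[ S ] (S ⊆ᴱ E G) × (card S ≤ k) × BicoloredP₃-Free (G ─ S)

------------------------------------------------------------------------
-- Machine model: a unit-cost RAM over ℕ with addition, truncated subtraction
-- and indirect addressing (no multiplication), programmed with while-loops.
-- A program mentions only finitely many of the arrays, so these could be
-- interleaved in a single memory at the price of a constant factor in time.

-- σ a i is the content of cell i of array a.
State : Set
State = ℕ → ℕ → ℕ

_[_,_↦_] : State → ℕ → ℕ → ℕ → State
(σ [ a , i ↦ x ]) b j = if ⌊ a ≟ b ⌋ ∧ ⌊ i ≟ j ⌋ then x else σ b j

infix  8 _[_]
infixl 7 _⊕_ _⊖_

data Exp : Set where
  lit     : ℕ → Exp
  _[_]    : (a : ℕ) → Exp → Exp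
  _⊕_ _⊖_ : Exp → Exp → Exp

⟦_⟧ : Exp → State → ℕ
⟦ lit x   ⟧ σ = x
⟦ a [ e ] ⟧ σ = σ a (⟦ e ⟧ σ)
⟦ e ⊕ f   ⟧ σ = ⟦ e ⟧ σ + ⟦ f ⟧ σ
⟦ e ⊖ f   ⟧ σ = ⟦ e ⟧ σ ∸ ⟦ f ⟧ σ

cost : Exp → ℕ
cost (lit x)   = 1
cost (a [ e ]) = 1 + cost e
cost (e ⊕ f)   = 1 + cost e + cost f
cost (e ⊖ f)   = 1 + cost e + cost f

infix  6 _[_]≔_
infixr 5 _⨾_

data Program : Set where
  skip          : Program
  _[_]≔_        : (a : ℕ) → Exp → Exp → Program
  _⨾_           : Program → Program → Program
  IF_THEN_ELSE_ : Exp → Program → Program → Program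
  WHILE_DO_     : Exp → Program → Program

infix 3 ⟨_,_⟩⇓_within_

-- ⟨ p , σ ⟩⇓ τ within t: started in σ, p halts in τ after exactly t steps.
-- Conditions are true when nonzero.
data ⟨_,_⟩⇓_within_ : Program → State → State → ℕ → Set where
  ⇓skip : ∀ {σ} →
    ⟨ skip , σ ⟩⇓ σ within 1
  ⇓assign : ∀ {a e f σ} →
    ⟨ a [ e ]≔ f , σ ⟩⇓ σ [ a , ⟦ e ⟧ σ ↦ ⟦ f ⟧ σ ] within 1 + cost e + cost f
  ⇓seq : ∀ {p q σ τ υ s t} →
    ⟨ p , σ ⟩⇓ τ within s → ⟨ q , τ ⟩⇓ υ within t →
    ⟨ p ⨾ q , σ ⟩⇓ υ within s + t
  ⇓then : ∀ {e p q σ τ t} → ⟦ e ⟧ σ ≢ 0 → ⟨ p , σ ⟩⇓ τ within t →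
    ⟨ IF e THEN p ELSE q , σ ⟩⇓ τ within cost e + t
  ⇓else : ∀ {e p q σ τ t} → ⟦ e ⟧ σ ≡ 0 → ⟨ q , σ ⟩⇓ τ within t →
    ⟨ IF e THEN p ELSE q , σ ⟩⇓ τ within cost e + t
  ⇓done : ∀ {e p σ} → ⟦ e ⟧ σ ≡ 0 →
    ⟨ WHILE e DO p , σ ⟩⇓ σ within cost e
  ⇓loop : ∀ {e p σ τ υ s t} → ⟦ e ⟧ σ ≢ 0 →
    ⟨ p , σ ⟩⇓ τ within s → ⟨ WHILE e DO p , τ ⟩⇓ υ within t →
    ⟨ WHILE e DO p , σ ⟩⇓ υ within cost e + s + t

------------------------------------------------------------------------
-- Representation of instances in memory

record ColoredEdge (n : ℕ) : Set where
  constructor edge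
  field
    src tgt : Fin n
    color   : Color

open ColoredEdge public

colorCode : Color → ℕ
colorCode red  = 0
colorCode blue = 1

-- The edges may be listed in any order, each with its smaller endpoint first.
record _Enumerates_ {n} (es : List (ColoredEdge n)) (E[_] : Color → EdgeSet n) : Set where
  field
    unique : Unique es
    exact  : ∀ {u v c} → edge u v c ∈ es ⇔ (u < v × E[ c ] ∋ u ─ v)

-- Array 0 begins with n, m, k; arrays 1, 2 and 3 begin with the smaller
-- endpoints, the larger endpoints and the colours of the listed edges.
record _Encodes_ (σ : State) (I : Instance) : Set where
  field
    edges      : List (ColoredEdge (order (graph I)))
    enumerates : edges Enumerates E[_] (graph I)
    n-stored   : σ 0 0 ≡ order (graph I)
    m-stored   : σ 0 1 ≡ length edges
    k-stored   : σ 0 2 ≡ budget I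
    src-stored : ∀ i → σ 1 (toℕ i) ≡ toℕ (src (lookup edges i))
    tgt-stored : ∀ i → σ 2 (toℕ i) ≡ toℕ (tgt (lookup edges i))
    col-stored : ∀ i → σ 3 (toℕ i) ≡ colorCode (color (lookup edges i))

BlankWorkspace : State → Set
BlankWorkspace σ = ∀ a i → 4 ≤ a → σ a i ≡ 0

{-# OPTIONS --safe #-}
module Submission where

-- Encode a red edge as 1, a blue edge as 3 and a non-edge as 0: then three
-- vertices induce a bicolored P₃ iff their three pairs add up to 4. The P₃s
-- through an edge uv need pairwise disjoint further deletions when uv is kept.
-- Hence the set F of edges lying in more than k P₃s is contained in every
-- solution, and it suffices to consider H = G − F with budget k − |F|. As
-- |F| ≤ k, every edge of H lies in at most B ≤ 2 min(k, Δ) P₃s of H. A solution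
-- meets all of them, so that at most k (2 + B) vertices lie in a P₃ of H, or the
-- instance is negative. The kernel is the subgraph of H induced by these
-- affected vertices and their neighbours in G.
--
-- If k ≥ m, then deleting everything is a solution. Otherwise k < m, which lets
-- the program compare with k (2 + B) by repeated subtraction, and all it does is
-- a constant number of passes over the vertices, over the edges, and over the
-- pairs of an edge and a vertex, using an adjacency matrix.

open import Defs
open import Data.Bool using (Bool; true; false; T; not; _∧_; _∨_; if_then_else_)
open import Data.Bool.Properties using (T-∧; T-∨; T?)
open import Data.Empty using (⊥; ⊥-elim)
open import Data.Fin as Fin using (Fin; zero; suc; toℕ; fromℕ<; combine)
open import Data.Fin.Patterns using (0F; 1F; 2F)
open import Data.Fin.Properties as Fin using (any?; all?; toℕ-fromℕ<; toℕ<n; toℕ-injective; toℕ-combine; combine-injective)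
open import Data.Fin.Subset using (Subset; ∣_∣)
open import Data.List using (List; []; _∷_; length; map; filter; take; allFin; _++_; _∷ʳ_; lookup; cartesianProduct)
open import Data.List.Extrema.Nat using (xs≤max)
open import Data.List.Membership.Propositional using (_∈_)
open import Data.List.Membership.Propositional.Properties
  using (∈-map⁺; ∈-map⁻; ∈-++⁺ˡ; ∈-++⁺ʳ; ∈-++⁻; ∈-filter⁺; ∈-filter⁻; ∈-allFin; ∈-cartesianProduct⁺; ∈-lookup)
open import Data.List.Properties
  using (length-++; length-map; length-tabulate; map-++; filter-++; filter-accept; filter-reject; filter-all; filter-≐;
         ++-identityʳ; take-suc; take-suc-tabulate; take-all)
open import Data.List.Relation.Unary.All as All using (All; []; _∷_)
open import Data.List.Relation.Unary.AllPairs using ([]; _∷_)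
open import Data.List.Relation.Unary.Any as Any using (Any; here; there)
open import Data.List.Relation.Unary.Any.Properties using (lookup-index)
open import Data.List.Relation.Unary.Unique.Propositional using (Unique)
import Data.List.Relation.Unary.Unique.Propositional.Properties as Unique
open import Data.Nat using (ℕ; zero; suc; _+_; _*_; _∸_; _≤_; _<_; _⊓_; _≡ᵇ_; _≟_; _<?_; _≤?_; z≤n; s≤s; >-nonZero)
open import Data.Nat.Properties hiding (_≟_; _<?_; _≤?_)
open import Data.Nat.Tactic.RingSolver using (solve-∀)
open import Data.Product using (_×_; _,_; proj₁; proj₂; Σ-syntax; ∃-syntax)
open import Data.Sum as Sum using (_⊎_; inj₁; inj₂)
open import Data.Unit using (⊤)
open import Data.Vec as Vec using ([]; _∷_)
open import Function using (_∘_; id)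
open import Function.Bundles using (Equivalence; _⇔_; mk⇔)
open import Relation.Binary using (Tri; tri<; tri≈; tri>)
open import Relation.Binary.PropositionalEquality hiding ([_])
open import Relation.Nullary using (¬_; Dec; yes; no; contradiction)
open import Relation.Nullary.Decidable
  using (⌊_⌋; toWitness; fromWitness; dec-true; dec-false; isYes≗does; decidable-stable; _×-dec_; _⊎-dec_; _→-dec_; ¬?)
open import Relation.Unary using (Decidable)

read-same : ∀ σ a i x → (σ [ a , i ↦ x ]) a i ≡ x
read-same σ a i x
  rewrite isYes≗does (a ≟ a) | isYes≗does (i ≟ i) | dec-true (a ≟ a) refl | dec-true (i ≟ i) refl = refl

read-other : ∀ σ a {i j} x → i ≢ j → (σ [ a , i ↦ x ]) a j ≡ σ a j
read-other σ a {i} {j} x i≢j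
  rewrite isYes≗does (a ≟ a) | isYes≗does (i ≟ j) | dec-true (a ≟ a) refl | dec-false (i ≟ j) i≢j = refl

read-array : ∀ σ {a b} i j x → a ≢ b → (σ [ a , i ↦ x ]) b j ≡ σ b j
read-array σ {a} {b} i j x a≢b
  rewrite isYes≗does (a ≟ b) | dec-false (a ≟ b) a≢b = refl

infix  6 _[_]:=_
infixr 5 _▸_
infix  6 WHEN_THEN_ FOR_<_DO_

-- RAM programs

-- In FOR c < j DO p, cell 0 of array c counts up to cell j of array 0.
data Code : Set where
  _[_]:=_    : ℕ → Exp → Exp → Code
  _▸_        : Code → Code → Code
  WHEN_THEN_ : Exp → Code → Code
  FOR_<_DO_  : ℕ → ℕ → Code → Code

compile : Code → Program
compile (a [ e ]:= f)     = a [ e ]≔ f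
compile (p ▸ q)           = compile p ⨾ compile q
compile (WHEN e THEN p)   = IF e THEN compile p ELSE skip
compile (FOR c < j DO p)  =
  c [ lit 0 ]≔ lit 0 ⨾
  WHILE 0 [ lit j ] ⊖ c [ lit 0 ] DO
    (compile p ⨾ c [ lit 0 ]≔ c [ lit 0 ] ⊕ lit 1)

run-when : ℕ → State → State → State
run-when zero    σ τ = σ
run-when (suc _) σ τ = τ

run  : Code → State → State
loop : ℕ → Code → State → ℕ → State
run (a [ e ]:= f)    σ = σ [ a , ⟦ e ⟧ σ ↦ ⟦ f ⟧ σ ]
run (p ▸ q)          σ = run q (run p σ)
run (WHEN e THEN p)  σ = run-when (⟦ e ⟧ σ) σ (run p σ)
run (FOR c < j DO p) σ = loop c p σ (σ 0 j)
loop c p σ zero    = σ [ c , 0 ↦ 0 ]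
loop c p σ (suc i) = run p (loop c p σ i) [ c , 0 ↦ suc i ]

keeps : ℕ → Code → Bool
keeps a (b [ e ]:= f)    = not (a ≡ᵇ b)
keeps a (p ▸ q)          = keeps a p ∧ keeps a q
keeps a (WHEN e THEN p)  = keeps a p
keeps a (FOR c < j DO p) = not (a ≡ᵇ c) ∧ keeps a p

∧-fst : ∀ {a b} → T (a ∧ b) → T a
∧-fst h = proj₁ (Equivalence.to T-∧ h)

∧-snd : ∀ {a b} → T (a ∧ b) → T b
∧-snd {a} h = proj₂ (Equivalence.to (T-∧ {a}) h)

≢ᵇ⇒≢ : ∀ a b → T (not (a ≡ᵇ b)) → a ≢ b
≢ᵇ⇒≢ a b h refl with a ≡ᵇ a | ≡⇒≡ᵇ a a refl
... | true | _ = h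

frame : ∀ p {a} → T (keeps a p) → ∀ σ x → run p σ a x ≡ σ a x
frame-loop : ∀ c p {a} → T (keeps a p) → T (not (a ≡ᵇ c)) →
             ∀ σ i x → loop c p σ i a x ≡ σ a x
frame (b [ e ]:= f) {a} h σ x =
  read-array σ (⟦ e ⟧ σ) x (⟦ f ⟧ σ) (≢-sym (≢ᵇ⇒≢ a b h))
frame (p ▸ q) {a} h σ x =
  trans (frame q (∧-snd {keeps a p} h) (run p σ) x) (frame p (∧-fst h) σ x)
frame (WHEN e THEN p) h σ x with ⟦ e ⟧ σ
... | zero  = refl
... | suc _ = frame p h σ x
frame (FOR c < j DO p) {a} h σ x =
  frame-loop c p (∧-snd {not (a ≡ᵇ c)} h) (∧-fst h) σ (σ 0 j) x
frame-loop c p {a} h g σ zero x = read-array σ 0 x 0 (≢-sym (≢ᵇ⇒≢ a c g))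
frame-loop c p {a} h g σ (suc i) x = trans
  (read-array (run p (loop c p σ i)) 0 x (suc i) (≢-sym (≢ᵇ⇒≢ a c g)))
  (trans (frame p h (loop c p σ i) x) (frame-loop c p h g σ i x))

counter : ∀ c p σ i → loop c p σ i c 0 ≡ i
counter c p σ zero    = read-same σ c 0 0
counter c p σ (suc i) = read-same (run p (loop c p σ i)) c 0 (suc i)

loop-induction : ∀ {c p σ n} (P : ℕ → State → Set) →
  P 0 (loop c p σ 0) →
  (∀ i → i < n → P i (loop c p σ i) → P (suc i) (loop c p σ (suc i))) →
  P n (loop c p σ n)
loop-induction {c} {p} {σ} {n} P base step = go n ≤-refl
  where
  go : ∀ i → i ≤ n → P i (loop c p σ i)
  go zero    _   = base
  go (suc i) i<n = step i i<n (go i (<⇒≤ i<n))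

-- Fits p β X: with loop bounds β, p takes O(X) steps; a loop over cell j fits
-- if its body takes O(Y) steps and β j * Y ≤ X.
Fits : Code → (ℕ → ℕ) → ℕ → Set
Fits (a [ e ]:= f)    β X = ⊤
Fits (p ▸ q)          β X = T (keeps 0 p) × Fits p β X × Fits q β X
Fits (WHEN e THEN p)  β X = Fits p β X
Fits (FOR c < j DO p) β X =
  T (keeps 0 p) × T (keeps c p) × T (not (0 ≡ᵇ c)) ×
  Σ[ Y ∈ ℕ ] (1 ≤ Y × β j * Y ≤ X × Fits p β Y)

weight : Code → ℕ
weight (a [ e ]:= f)    = 1 + cost e + cost f
weight (p ▸ q)          = weight p + weight q
weight (WHEN e THEN p)  = cost e + (1 + weight p)
weight (FOR c < j DO p) = 8 + (11 + weight p)

_⇓_≤_ : Program × State → State → ℕ → Set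
(p , σ) ⇓ τ ≤ X = ∃[ t ] (⟨ p , σ ⟩⇓ τ within t) × t ≤ X

compile-correct : ∀ p {β X} → Fits p β X → 1 ≤ X → ∀ σ → (∀ j → σ 0 j ≡ β j) →
  (compile p , σ) ⇓ run p σ ≤ (weight p * X)

while-correct : ∀ c j p {β Y} → T (keeps 0 p) → T (keeps c p) → T (not (0 ≡ᵇ c)) →
  1 ≤ Y → Fits p β Y → ∀ σ → (∀ j → σ 0 j ≡ β j) →
  ∀ r i → i + r ≡ β j →
  (WHILE 0 [ lit j ] ⊖ c [ lit 0 ] DO (compile p ⨾ c [ lit 0 ]≔ c [ lit 0 ] ⊕ lit 1)
    , loop c p σ i) ⇓ loop c p σ (β j) ≤ (r * ((11 + weight p) * Y) + 5)

compile-correct (a [ e ]:= f) _ 1≤X σ _ = _ , ⇓assign ,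
  m≤m*n (weight (a [ e ]:= f)) _ ⦃ >-nonZero 1≤X ⦄
compile-correct (p ▸ q) {β} {X} (h , fp , fq) 1≤X σ agree
  with s , ds , s≤ ← compile-correct p fp 1≤X σ agree
     | t , dt , t≤ ← compile-correct q fq 1≤X (run p σ) (λ j → trans (frame p h σ j) (agree j))
  = s + t , ⇓seq ds dt ,
    subst (s + t ≤_) (sym (*-distribʳ-+ X (weight p) (weight q))) (+-mono-≤ s≤ t≤)
compile-correct (WHEN e THEN p) {β} {X} fp 1≤X σ agree with ⟦ e ⟧ σ in eq
... | zero  = cost e + 1 , ⇓else eq ⇓skip ,
  ≤-trans (+-monoʳ-≤ (cost e) (s≤s z≤n)) (m≤m*n (cost e + (1 + weight p)) X ⦃ >-nonZero 1≤X ⦄)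
... | suc _ with t , d , t≤ ← compile-correct p fp 1≤X σ agree =
  cost e + t , ⇓then (λ z → contradiction (trans (sym eq) z) λ ()) d ,
  subst (cost e + t ≤_) (sym (*-distribʳ-+ X (cost e) (1 + weight p)))
    (+-mono-≤ (m≤m*n (cost e) X ⦃ >-nonZero 1≤X ⦄) (≤-trans t≤ (*-monoˡ-≤ X (n≤1+n (weight p)))))
compile-correct (FOR c < j DO p) {β} {X} (h₀ , hᶜ , 0≢c , Y , 1≤Y , Y≤ , fp) 1≤X σ agree
  rewrite agree j
  with t , d , t≤ ← while-correct c j p h₀ hᶜ 0≢c 1≤Y fp σ agree (β j) 0 refl
  = 3 + t , ⇓seq ⇓assign d , (begin
    3 + t                                   ≤⟨ +-monoʳ-≤ 3 t≤ ⟩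
    3 + (β j * ((11 + w) * Y) + 5)          ≡⟨ cong (3 +_) (+-comm (β j * ((11 + w) * Y)) 5) ⟩
    8 + β j * ((11 + w) * Y)                ≡⟨ cong (8 +_) (trans (cong (β j *_) (*-comm (11 + w) Y)) (sym (*-assoc (β j) Y (11 + w)))) ⟩
    8 + β j * Y * (11 + w)                  ≤⟨ +-mono-≤ (m≤m*n 8 X ⦃ >-nonZero 1≤X ⦄) (*-monoˡ-≤ (11 + w) Y≤) ⟩
    8 * X + X * (11 + w)                    ≡⟨ cong (8 * X +_) (*-comm X (11 + w)) ⟩
    8 * X + (11 + w) * X                    ≡⟨ *-distribʳ-+ X 8 (11 + w) ⟨
    (8 + (11 + w)) * X                      ∎)
  where
  open ≤-Reasoning
  w : ℕ
  w = weight p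

while-correct c j p {β} {Y} h₀ hᶜ 0≢c 1≤Y fp σ agree zero i eq =
  5 , subst (λ x → ⟨ _ , loop c p σ i ⟩⇓ loop c p σ x within 5) (trans (sym (+-identityʳ i)) eq) (⇓done stop) , ≤-refl
  where
  stop : loop c p σ i 0 j ∸ loop c p σ i c 0 ≡ 0
  stop rewrite counter c p σ i | frame-loop c p h₀ 0≢c σ i j | agree j | sym eq | +-identityʳ i = n∸n≡0 i
while-correct c j p {β} {Y} h₀ hᶜ 0≢c 1≤Y fp σ agree (suc r) i eq
  with s , ds , s≤ ← compile-correct p fp 1≤Y (loop c p σ i)
                       (λ x → trans (frame-loop c p h₀ 0≢c σ i x) (agree x))
     | t , dt , t≤ ← while-correct c j p h₀ hᶜ 0≢c 1≤Y fp σ agree r (suc i) (trans (sym (+-suc i r)) eq)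
  = _ , ⇓loop go (⇓seq ds next) dt , (begin
    5 + (s + 6) + t                           ≡⟨ cong (λ x → 5 + x + t) (+-comm s 6) ⟩
    11 + s + t                                ≤⟨ +-mono-≤ (+-mono-≤ (m≤m*n 11 Y ⦃ >-nonZero 1≤Y ⦄) s≤) t≤ ⟩
    11 * Y + w * Y + (r * ((11 + w) * Y) + 5) ≡⟨ cong (_+ (r * ((11 + w) * Y) + 5)) (*-distribʳ-+ Y 11 w) ⟨
    (11 + w) * Y + (r * ((11 + w) * Y) + 5)   ≡⟨ +-assoc ((11 + w) * Y) (r * ((11 + w) * Y)) 5 ⟨
    suc r * ((11 + w) * Y) + 5                ∎)
  where
  open ≤-Reasoning
  w : ℕ
  w = weight p
  τ : State
  τ = loop c p σ i
  go : τ 0 j ∸ τ c 0 ≢ 0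
  go rewrite counter c p σ i | frame-loop c p h₀ 0≢c σ i j | agree j | sym eq | m+n∸m≡n i (suc r) = λ ()
  next : ⟨ c [ lit 0 ]≔ c [ lit 0 ] ⊕ lit 1 , run p τ ⟩⇓ run p τ [ c , 0 ↦ suc i ] within 6
  next = subst (λ x → ⟨ c [ lit 0 ]≔ c [ lit 0 ] ⊕ lit 1 , run p τ ⟩⇓ run p τ [ c , 0 ↦ x ] within 6)
    (trans (+-comm (run p τ c 0) 1) (cong suc (trans (frame p hᶜ τ 0) (counter c p σ i)))) ⇓assign

-- Counting in lists

module _ {A B : Set} (R : A → B → Set) where

  split : ∀ y ys xs → Unique xs → (∀ {x} → x ∈ xs → Any (R x) (y ∷ ys)) →
    ∃[ zs ] ∃[ ws ] (length xs ≡ length zs + length ws) × Unique zs × Unique ws ×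
      All (λ z → R z y) zs × (∀ {x} → x ∈ ws → Any (R x) ys) ×
      (∀ {x} → x ∈ zs → x ∈ xs) × (∀ {x} → x ∈ ws → x ∈ xs)
  split y ys [] u h = [] , [] , refl , [] , [] , [] , (λ ()) , (λ ()) , (λ ())
  split y ys (x ∷ xs) (x∉ ∷ u) h
    with zs , ws , len , uz , uw , rz , rw , z⊆ , w⊆ ← split y ys xs u (h ∘ there) | h (here refl)
  ... | here r  = x ∷ zs , ws , cong suc len , All.tabulate (All.lookup x∉ ∘ z⊆) ∷ uz , uw , r ∷ rz , rw ,
    (λ { (here e) → here e ; (there i) → there (z⊆ i) }) , there ∘ w⊆
  ... | there r = zs , x ∷ ws , trans (cong suc len) (sym (+-suc (length zs) (length ws))) , uz ,
    All.tabulate (All.lookup x∉ ∘ w⊆) ∷ uw , rz , (λ { (here refl) → r ; (there i) → rw i }) ,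
    there ∘ z⊆ , (λ { (here e) → here e ; (there i) → there (w⊆ i) })

  cover : ∀ {d} ys xs → Unique xs → (∀ {x} → x ∈ xs → Any (R x) ys) →
    (∀ {y} → y ∈ ys → ∀ zs → Unique zs → All (λ z → R z y) zs → length zs ≤ d) →
    length xs ≤ length ys * d
  cover [] [] u h b = z≤n
  cover [] (x ∷ xs) u h b with () ← h (here refl)
  cover {d} (y ∷ ys) xs u h b
    with zs , ws , len , uz , uw , rz , rw , _ ← split y ys xs u h
    = subst (_≤ d + length ys * d) (sym len) (+-mono-≤ (b (here refl) zs uz rz) (cover ys ws uw rw (b ∘ there)))

  inject : ∀ xs ys → Unique xs → (∀ {x} → x ∈ xs → ∃[ y ] (y ∈ ys × R x y)) →
    (∀ {x x′ y} → R x y → R x′ y → x ≡ x′) → length xs ≤ length ys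
  inject xs ys u h inj = subst (length xs ≤_) (*-identityʳ (length ys))
    (cover ys xs u (λ i → let y , y∈ , r = h i in Any.map (λ { refl → r }) y∈) λ _ → single)
    where
    single : ∀ {y} zs → Unique zs → All (λ z → R z y) zs → length zs ≤ 1
    single [] _ _ = z≤n
    single (_ ∷ []) _ _ = s≤s z≤n
    single (_ ∷ _ ∷ _) ((z≢ ∷ _) ∷ _) (r ∷ r′ ∷ _) = contradiction (inj r r′) z≢

length-⊆ : {A : Set} (xs ys : List A) → Unique xs → (∀ {x} → x ∈ xs → x ∈ ys) → length xs ≤ length ys
length-⊆ xs ys u h = inject _≡_ xs ys u (λ {x} i → x , h i , refl) (λ p q → trans p (sym q))

module _ {A : Set} {P : A → Set} (P? : Decidable P) where

  count : List A → ℕ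
  count xs = length (filter P? xs)

  filter-∷ʳ-no : ∀ xs {x} → ¬ P x → filter P? (xs ∷ʳ x) ≡ filter P? xs
  filter-∷ʳ-no xs {x} ¬p = trans (filter-++ P? xs (x ∷ []))
    (trans (cong (filter P? xs ++_) (filter-reject P? ¬p)) (++-identityʳ (filter P? xs)))

  filter-∷ʳ-yes : ∀ xs {x} → P x → filter P? (xs ∷ʳ x) ≡ filter P? xs ∷ʳ x
  filter-∷ʳ-yes xs {x} p = trans (filter-++ P? xs (x ∷ [])) (cong (filter P? xs ++_) (filter-accept P? p))

  count-∷ʳ-yes : ∀ xs {x} → P x → count (xs ∷ʳ x) ≡ suc (count xs)
  count-∷ʳ-yes xs {x} p = trans (cong length (filter-∷ʳ-yes xs p))
    (trans (length-++ (filter P? xs)) (+-comm (count xs) 1))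

elements : ∀ {n} → Subset n → List (Fin n)
elements []           = []
elements (true  ∷ p)  = zero ∷ map suc (elements p)
elements (false ∷ p)  = map suc (elements p)

length-elements : ∀ {n} (p : Subset n) → length (elements p) ≡ ∣ p ∣
length-elements []          = refl
length-elements (true  ∷ p) = cong suc (trans (length-map suc (elements p)) (length-elements p))
length-elements (false ∷ p) = trans (length-map suc (elements p)) (length-elements p)

∈-elements : ∀ {n} (f : Fin n → Bool) v → T (f v) → v ∈ elements (Vec.tabulate f)
∈-elements f zero h with f zero
... | true = here refl
∈-elements f (suc v) h with f zero
... | true  = there (∈-map⁺ suc (∈-elements (f ∘ suc) v h))
... | false = ∈-map⁺ suc (∈-elements (f ∘ suc) v h)

-- Edge sets and weights

edgeSet : ∀ {n} (P : Fin n → Fin n → Set) → (∀ u v → Dec (P u v)) →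
          (∀ {u v} → P u v → P v u) → (∀ {u} → ¬ P u u) → EdgeSet n
edgeSet P P? swap irr = record
  { has       = λ u v → ⌊ P? u v ⌋
  ; symmetric = sy
  ; loopless  = lo
  }
  where
  sy : ∀ u v → ⌊ P? u v ⌋ ≡ ⌊ P? v u ⌋
  sy u v with P? u v | P? v u
  ... | yes p | yes q = refl
  ... | yes p | no ¬q = contradiction (swap p) ¬q
  ... | no ¬p | yes q = contradiction (swap q) ¬p
  ... | no ¬p | no ¬q = refl
  lo : ∀ u → ⌊ P? u u ⌋ ≡ false
  lo u with P? u u
  ... | yes p = contradiction p irr
  ... | no ¬p = refl

module _ {n} (S : EdgeSet n) where

  swap-edge : ∀ {u v} → S ∋ u ─ v → S ∋ v ─ u
  swap-edge {u} {v} = subst T (symmetric S u v)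

  not-loop : ∀ {u} → ¬ S ∋ u ─ u
  not-loop {u} = subst T (loopless S u)

  ∈-pairs⁺ : ∀ {u v} → u Fin.< v → S ∋ u ─ v → (u , v) ∈ pairs S
  ∈-pairs⁺ {u} {v} u<v h = ∈-filter⁺ (λ (u , v) → (u Fin.<? v) ×-dec T? (has S u v))
    (∈-cartesianProduct⁺ (∈-allFin u) (∈-allFin v)) (u<v , h)

  ∈-pairs⁻ : ∀ {u v} → (u , v) ∈ pairs S → u Fin.< v × S ∋ u ─ v
  ∈-pairs⁻ i = proj₂ (∈-filter⁻ (λ (u , v) → (u Fin.<? v) ×-dec T? (has S u v))
    {xs = cartesianProduct (allFin n) (allFin n)} i)

  pairs-unique : Unique (pairs S)
  pairs-unique = Unique.filter⁺ (λ (u , v) → (u Fin.<? v) ×-dec T? (has S u v))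
    (Unique.cartesianProduct⁺ (Unique.allFin⁺ n) (Unique.allFin⁺ n))

  orient : ∀ {u v} → S ∋ u ─ v → (u , v) ∈ pairs S ⊎ (v , u) ∈ pairs S
  orient {u} {v} h with Fin.<-cmp u v
  ... | tri< u<v _ _ = inj₁ (∈-pairs⁺ u<v h)
  ... | tri≈ _ refl _ = contradiction h not-loop
  ... | tri> _ _ v<u = inj₂ (∈-pairs⁺ v<u (swap-edge h))

data Value : ℕ → Set where
  none  : Value 0
  red₁  : Value 1
  blue₃ : Value 3

record Weight (n : ℕ) : Set where
  field
    γ     : Fin n → Fin n → ℕ
    γ-sym : ∀ u v → γ u v ≡ γ v u
    γ-irr : ∀ u → γ u u ≡ 0
    value : ∀ u v → Value (γ u v)

open Weight

code : Bool → Bool → ℕ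
code true  _     = 1
code false true  = 3
code false false = 0

code-value : ∀ a b → Value (code a b)
code-value true  _     = red₁
code-value false true  = blue₃
code-value false false = none

graphWeight : (G : TwoColoredGraph) → Weight (order G)
graphWeight G = record
  { γ     = λ u v → code (has (Eᵣ G) u v) (has (Eᵇ G) u v)
  ; γ-sym = λ u v → cong₂ code (symmetric (Eᵣ G) u v) (symmetric (Eᵇ G) u v)
  ; γ-irr = λ u → cong₂ code (loopless (Eᵣ G) u) (loopless (Eᵇ G) u)
  ; value = λ u v → code-value (has (Eᵣ G) u v) (has (Eᵇ G) u v)
  }

mask : ∀ {n} → Weight n → EdgeSet n → Weight n
mask w S = record
  { γ     = λ u v → if has S u v then 0 else γ w u v
  ; γ-sym = λ u v → cong₂ (λ b x → if b then 0 else x) (symmetric S u v) (γ-sym w u v)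
  ; γ-irr = λ u → trans (cong (λ b → if b then 0 else γ w u u) (loopless S u)) (γ-irr w u)
  ; value = λ u v → val (has S u v) (value w u v)
  }
  where
  val : ∀ b {x} → Value x → Value (if b then 0 else x)
  val true  _ = none
  val false v = v

-- Among the values 0, 1 and 3, a sum of three is 4 only for 0 + 1 + 3.
P₃ : ∀ {n} → Weight n → Fin n → Fin n → Fin n → Set
P₃ w u v x = γ w u v + γ w v x + γ w u x ≡ 4

Free : ∀ {n} → Weight n → Set
Free w = ∀ u v x → ¬ P₃ w u v x

Solvable : ∀ {n} → Weight n → ℕ → Set
Solvable {n} w k = ∃[ S ] (card {n} S ≤ k) × Free (mask w S)

module _ {n} (w : Weight n) where

  P₃-swap : ∀ {u v x} → P₃ w u v x → P₃ w v u x
  P₃-swap {u} {v} {x} p = trans (trans (+-assoc (γ w v u) (γ w u x) (γ w v x))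
    (trans (cong₂ _+_ (γ-sym w v u) (+-comm (γ w u x) (γ w v x))) (sym (+-assoc (γ w u v) (γ w v x) (γ w u x))))) p

  P₃-rotate : ∀ {u v x} → P₃ w u v x → P₃ w v x u
  P₃-rotate {u} {v} {x} p = trans (trans (+-assoc (γ w v x) (γ w x u) (γ w v u))
    (trans (cong (γ w v x +_) (trans (cong₂ _+_ (γ-sym w x u) (γ-sym w v u)) (+-comm (γ w u x) (γ w u v))))
    (trans (sym (+-assoc (γ w v x) (γ w u v) (γ w u x))) (cong (_+ γ w u x) (+-comm (γ w v x) (γ w u v)))))) p

  P₃-path : ∀ {u v x} → P₃ w u v x → ∃[ a ] ∃[ b ] ∃[ c ] (γ w a b ≡ 1 × γ w b c ≡ 3 × γ w a c ≡ 0)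
  P₃-path {u} {v} {x} p with γ w u v in uv | γ w v x in vx | γ w u x in ux | value w u v | value w v x | value w u x
  ... | _ | _ | _ | none  | red₁  | blue₃ = v , x , u , vx , trans (γ-sym w x u) ux , trans (γ-sym w v u) uv
  ... | _ | _ | _ | none  | blue₃ | red₁  = u , x , v , ux , trans (γ-sym w x v) vx , uv
  ... | _ | _ | _ | red₁  | none  | blue₃ = v , u , x , trans (γ-sym w v u) uv , ux , vx
  ... | _ | _ | _ | red₁  | blue₃ | none  = u , v , x , uv , vx , ux
  ... | _ | _ | _ | blue₃ | none  | red₁  = x , u , v , trans (γ-sym w x u) ux , uv , trans (γ-sym w x v) vx
  ... | _ | _ | _ | blue₃ | red₁  | none  = x , v , u , trans (γ-sym w x v) vx , trans (γ-sym w v u) uv , trans (γ-sym w x u) ux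
  P₃-path () | _ | _ | _ | none  | none  | none
  P₃-path () | _ | _ | _ | none  | none  | red₁
  P₃-path () | _ | _ | _ | none  | none  | blue₃
  P₃-path () | _ | _ | _ | none  | red₁  | none
  P₃-path () | _ | _ | _ | none  | red₁  | red₁
  P₃-path () | _ | _ | _ | none  | blue₃ | none
  P₃-path () | _ | _ | _ | none  | blue₃ | blue₃
  P₃-path () | _ | _ | _ | red₁  | none  | none
  P₃-path () | _ | _ | _ | red₁  | none  | red₁
  P₃-path () | _ | _ | _ | red₁  | red₁  | none
  P₃-path () | _ | _ | _ | red₁  | red₁  | red₁
  P₃-path () | _ | _ | _ | red₁  | red₁  | blue₃
  P₃-path () | _ | _ | _ | red₁  | blue₃ | red₁
  P₃-path () | _ | _ | _ | red₁  | blue₃ | blue₃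
  P₃-path () | _ | _ | _ | blue₃ | none  | none
  P₃-path () | _ | _ | _ | blue₃ | none  | blue₃
  P₃-path () | _ | _ | _ | blue₃ | red₁  | red₁
  P₃-path () | _ | _ | _ | blue₃ | red₁  | blue₃
  P₃-path () | _ | _ | _ | blue₃ | blue₃ | none
  P₃-path () | _ | _ | _ | blue₃ | blue₃ | red₁
  P₃-path () | _ | _ | _ | blue₃ | blue₃ | blue₃

  thirds : Fin n → Fin n → List (Fin n)
  thirds u v = filter (λ x → γ w u v + γ w v x + γ w u x ≟ 4) (allFin n)

  ∈-thirds⁺ : ∀ {u v x} → P₃ w u v x → x ∈ thirds u v
  ∈-thirds⁺ {u} {v} {x} p = ∈-filter⁺ (λ x → γ w u v + γ w v x + γ w u x ≟ 4) (∈-allFin x) p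

  ∈-thirds⁻ : ∀ {u v x} → x ∈ thirds u v → P₃ w u v x
  ∈-thirds⁻ {u} {v} i = proj₂ (∈-filter⁻ (λ x → γ w u v + γ w v x + γ w u x ≟ 4) {xs = allFin n} i)

  thirds-unique : ∀ u v → Unique (thirds u v)
  thirds-unique u v = Unique.filter⁺ (λ x → γ w u v + γ w v x + γ w u x ≟ 4) (Unique.allFin⁺ n)

  thirds-sym : ∀ u v → thirds u v ≡ thirds v u
  thirds-sym u v = filter-≐ (λ x → γ w u v + γ w v x + γ w u x ≟ 4) (λ x → γ w v u + γ w u x + γ w v x ≟ 4)
    (P₃-swap , P₃-swap) (allFin n)

  P₃⇒≢ : ∀ {u v} → ¬ P₃ w u v u
  P₃⇒≢ {u} {v} p rewrite γ-irr w u | γ-sym w v u with γ w u v | value w u v | p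
  ... | _ | none  | ()
  ... | _ | red₁  | ()
  ... | _ | blue₃ | ()

Joins : ∀ {n} (u v x : Fin n) → Fin n × Fin n → Set
Joins u v x (s , t) = (s ≡ x × (t ≡ u ⊎ t ≡ v)) ⊎ (t ≡ x × (s ≡ u ⊎ s ≡ v))

module _ {n} (w : Weight n) {u v : Fin n} where

  Joins-injective : ∀ {x x′ p} → P₃ w u v x → P₃ w u v x′ → Joins u v x p → Joins u v x′ p → x ≡ x′
  Joins-injective {x} {x′} p p′ = go
    where
    outside : ∀ {y} → P₃ w u v y → ¬ (y ≡ u ⊎ y ≡ v)
    outside q (inj₁ refl) = P₃⇒≢ w q
    outside q (inj₂ refl) = P₃⇒≢ w (P₃-swap w q)
    go : ∀ {q} → Joins u v x q → Joins u v x′ q → x ≡ x′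
    go (inj₁ (refl , _)) (inj₁ (refl , _)) = refl
    go (inj₁ (refl , h)) (inj₂ (refl , _)) = contradiction h (outside p′)
    go (inj₂ (refl , h)) (inj₁ (refl , _)) = contradiction h (outside p′)
    go (inj₂ (refl , _)) (inj₂ (refl , _)) = refl

  joining-pair : ∀ (S : EdgeSet n) {x} → S ∋ v ─ x ⊎ S ∋ u ─ x → ∃[ q ] (q ∈ pairs S × Joins u v x q)
  joining-pair S (inj₁ h) with orient S h
  ... | inj₁ i = _ , i , inj₂ (refl , inj₂ refl)
  ... | inj₂ i = _ , i , inj₁ (refl , inj₂ refl)
  joining-pair S (inj₂ h) with orient S h
  ... | inj₁ i = _ , i , inj₂ (refl , inj₁ refl)
  ... | inj₂ i = _ , i , inj₁ (refl , inj₁ refl)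

mask-cases : ∀ {n} (w : Weight n) S u v → γ (mask w S) u v ≡ γ w u v ⊎ (S ∋ u ─ v × γ w u v ≢ 0)
mask-cases w S u v with has S u v | γ w u v
... | false | _     = inj₁ refl
... | true  | zero  = inj₁ refl
... | true  | suc _ = inj₂ (_ , λ ())

mask-true : ∀ {n} (w : Weight n) S {u v} → S ∋ u ─ v → γ (mask w S) u v ≡ 0
mask-true w S {u} {v} h with true ← has S u v = refl

mask-false : ∀ {n} (w : Weight n) S {u v} → ¬ S ∋ u ─ v → γ (mask w S) u v ≡ γ w u v
mask-false w S {u} {v} h with has S u v
... | false = refl
... | true  = contradiction _ h

hit : ∀ {n} (w : Weight n) S → Free (mask w S) → ∀ {u v x} → P₃ w u v x →
  (S ∋ u ─ v × γ w u v ≢ 0) ⊎ (S ∋ v ─ x × γ w v x ≢ 0) ⊎ (S ∋ u ─ x × γ w u x ≢ 0)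
hit w S free {u} {v} {x} p with mask-cases w S u v | mask-cases w S v x | mask-cases w S u x
... | inj₂ h | _      | _      = inj₁ h
... | inj₁ _ | inj₂ h | _      = inj₂ (inj₁ h)
... | inj₁ _ | inj₁ _ | inj₂ h = inj₂ (inj₂ h)
... | inj₁ a | inj₁ b | inj₁ c = contradiction (trans (cong₂ _+_ (cong₂ _+_ a b) c) p) (free u v x)

undeleted : ∀ {n} (w : Weight n) S → Free (mask w S) → ∀ {u v} → ¬ S ∋ u ─ v → length (thirds w u v) ≤ card S
undeleted w S free {u} {v} uv∉S =
  inject (λ x q → P₃ w u v x × Joins u v x q) (thirds w u v) (pairs S) (thirds-unique w u v) covered
    (λ (p , j) (p′ , j′) → Joins-injective w p p′ j j′)
  where
  covered : ∀ {x} → x ∈ thirds w u v → ∃[ q ] (q ∈ pairs S × P₃ w u v x × Joins u v x q)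
  covered i with p ← ∈-thirds⁻ w i | hit w S free (∈-thirds⁻ w i)
  ... | inj₁ (h , _) = contradiction h uv∉S
  ... | inj₂ h = let q , q∈ , j = joining-pair w S (Sum.map proj₁ proj₁ h) in q , q∈ , p , j

module _ {n} (A B : EdgeSet n) where

  card-∖ : B ⊆ᴱ A → card (A ∖ᴱ B) + card B ≤ card A
  card-∖ B⊆A = subst (_≤ card A) (length-++ (pairs (A ∖ᴱ B))) (length-⊆ _ _
    (Unique.++⁺ (pairs-unique (A ∖ᴱ B)) (pairs-unique B) (λ (i , j) → apart (∈-pairs⁻ (A ∖ᴱ B) i) (∈-pairs⁻ B j))) within)
    where
    apart : ∀ {u v} → u Fin.< v × (A ∖ᴱ B) ∋ u ─ v → u Fin.< v × B ∋ u ─ v → ⊥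
    apart {u} {v} (_ , h) (_ , g) with has A u v | has B u v
    ... | true | true = h
    within : ∀ {q} → q ∈ pairs (A ∖ᴱ B) ++ pairs B → q ∈ pairs A
    within i with ∈-++⁻ (pairs (A ∖ᴱ B)) i
    ... | inj₁ j = let u<v , h = ∈-pairs⁻ (A ∖ᴱ B) j in ∈-pairs⁺ A u<v (proj₁ (Equivalence.to T-∧ h))
    ... | inj₂ j = let u<v , h = ∈-pairs⁻ B j in ∈-pairs⁺ A u<v (B⊆A _ _ h)

  card-∪ : card (A ∪ᴱ B) ≤ card A + card B
  card-∪ = subst (card (A ∪ᴱ B) ≤_) (length-++ (pairs A)) (length-⊆ _ _ (pairs-unique (A ∪ᴱ B)) within)
    where
    within : ∀ {q} → q ∈ pairs (A ∪ᴱ B) → q ∈ pairs A ++ pairs B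
    within {u , v} i with u<v , h ← ∈-pairs⁻ (A ∪ᴱ B) i | Equivalence.to (T-∨ {has A u v}) (proj₂ (∈-pairs⁻ (A ∪ᴱ B) i))
    ... | inj₁ g = ∈-++⁺ˡ (∈-pairs⁺ A u<v g)
    ... | inj₂ g = ∈-++⁺ʳ (pairs A) (∈-pairs⁺ B u<v g)

Free-cong : ∀ {n} (w w′ : Weight n) → (∀ u v → γ w u v ≡ γ w′ u v) → Free w → Free w′
Free-cong w w′ eq free u v x p =
  free u v x (trans (cong₂ _+_ (cong₂ _+_ (eq u v) (eq v x)) (eq u x)) p)

module Forced {n} (w : Weight n) (k : ℕ) where

  IsForced : Fin n → Fin n → Set
  IsForced u v = γ w u v ≢ 0 × k < length (thirds w u v)

  isForced? : ∀ u v → Dec (IsForced u v)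
  isForced? u v = ¬? (γ w u v ≟ 0) ×-dec (k <? length (thirds w u v))

  forced : EdgeSet n
  forced = edgeSet IsForced isForced?
    (λ {u} {v} (e , l) → subst (_≢ 0) (γ-sym w u v) e , subst (λ xs → k < length xs) (thirds-sym w u v) l)
    (λ {u} (e , _) → e (γ-irr w u))

  rest : Weight n
  rest = mask w forced

  forced⁻ : ∀ {u v} → forced ∋ u ─ v → IsForced u v
  forced⁻ = toWitness

  forced⁺ : ∀ {u v} → IsForced u v → forced ∋ u ─ v
  forced⁺ = fromWitness

  module _ (S : EdgeSet n) (S≤k : card S ≤ k) (free : Free (mask w S)) where

    forced⊆ : forced ⊆ᴱ S
    forced⊆ u v h = decidable-stable (T? (has S u v)) λ uv∉S →
      ≤⇒≯ (≤-trans (undeleted w S free uv∉S) S≤k) (proj₂ (forced⁻ h))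

    forced≤ : card forced ≤ k
    forced≤ = ≤-trans (m≤n+m (card forced) (card (S ∖ᴱ forced))) (≤-trans (card-∖ S forced forced⊆) S≤k)

  solvable-rest⁺ : Solvable w k → Solvable rest (k ∸ card forced)
  solvable-rest⁺ (S , S≤k , free) = S ∖ᴱ forced ,
    subst (_≤ k ∸ card forced) (m+n∸n≡m (card (S ∖ᴱ forced)) (card forced))
      (∸-monoˡ-≤ (card forced) (≤-trans (card-∖ S forced (forced⊆ S S≤k free)) S≤k)) ,
    Free-cong (mask w S) (mask rest (S ∖ᴱ forced)) same free
    where
    same : ∀ u v → γ (mask w S) u v ≡ γ (mask rest (S ∖ᴱ forced)) u v
    same u v with has forced u v in f | has S u v in s
    ... | true  | true  = refl
    ... | true  | false = ⊥-elim (subst T s (forced⊆ S S≤k free u v (subst T (sym f) _)))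
    ... | false | true  = refl
    ... | false | false = refl

  solvable-rest⁻ : card forced ≤ k → Solvable rest (k ∸ card forced) → Solvable w k
  solvable-rest⁻ F≤k (S , S≤ , free) = S ∪ᴱ forced ,
    ≤-trans (card-∪ S forced) (subst (card S + card forced ≤_) (m∸n+n≡m F≤k) (+-monoˡ-≤ (card forced) S≤)) ,
    Free-cong (mask rest S) (mask w (S ∪ᴱ forced)) same free
    where
    same : ∀ u v → γ (mask rest S) u v ≡ γ (mask w (S ∪ᴱ forced)) u v
    same u v with has forced u v | has S u v
    ... | true  | true  = refl
    ... | true  | false = refl
    ... | false | true  = refl
    ... | false | false = refl

  thirds-rest : card forced ≤ k → ∀ {u v} → γ rest u v ≢ 0 → length (thirds rest u v) ≤ k + k
  thirds-rest F≤k {u} {v} uv≢0 = ≤-trans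
    (inject R (thirds rest u v) (map inj₁ (thirds w u v) ++ map inj₂ (pairs forced)) (thirds-unique rest u v) covered injective)
    (subst (_≤ k + k) (sym (trans (length-++ (map inj₁ (thirds w u v)))
      (cong₂ _+_ (length-map inj₁ (thirds w u v)) (length-map inj₂ (pairs forced)))))
      (+-mono-≤ few F≤k))
    where
    ¬uv : ¬ forced ∋ u ─ v
    ¬uv h = uv≢0 (mask-true w forced h)
    few : length (thirds w u v) ≤ k
    few = ≮⇒≥ λ l → ¬uv (forced⁺ (subst (_≢ 0) (mask-false w forced ¬uv) uv≢0 , l))
    R : Fin n → Fin n ⊎ (Fin n × Fin n) → Set
    R x (inj₁ y) = x ≡ y
    R x (inj₂ q) = P₃ rest u v x × Joins u v x q
    injective : ∀ {x x′ y} → R x y → R x′ y → x ≡ x′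
    injective {y = inj₁ _} refl refl = refl
    injective {y = inj₂ _} (p , j) (p′ , j′) = Joins-injective rest p p′ j j′
    covered : ∀ {x} → x ∈ thirds rest u v →
      ∃[ y ] (y ∈ map inj₁ (thirds w u v) ++ map inj₂ (pairs forced) × R x y)
    covered {x} i with p ← ∈-thirds⁻ rest i | T? (has forced v x) | T? (has forced u x)
    ... | yes h | _     = let q , q∈ , j = joining-pair w forced (inj₁ h) in
      inj₂ q , ∈-++⁺ʳ (map inj₁ (thirds w u v)) (∈-map⁺ inj₂ q∈) , p , j
    ... | no _  | yes h = let q , q∈ , j = joining-pair w forced (inj₂ h) in
      inj₂ q , ∈-++⁺ʳ (map inj₁ (thirds w u v)) (∈-map⁺ inj₂ q∈) , p , j
    ... | no a  | no b  = inj₁ x , ∈-++⁺ˡ (∈-map⁺ inj₁ (∈-thirds⁺ w (trans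
      (sym (cong₂ _+_ (cong₂ _+_ (mask-false w forced ¬uv) (mask-false w forced a)) (mask-false w forced b))) p))) , refl

module _ {n} (w : Weight n) where

  Affected : Fin n → Set
  Affected x = ∃[ u ] ∃[ v ] P₃ w x u v

  few-affected : ∀ {k B} → Solvable w k → (∀ {u v} → γ w u v ≢ 0 → length (thirds w u v) ≤ B) →
    ∀ xs → Unique xs → (∀ {x} → x ∈ xs → Affected x) → length xs ≤ k * (2 + B)
  few-affected {k} {B} (S , S≤k , free) few xs unique affected =
    ≤-trans (cover R (pairs S) xs unique (covered ∘ affected) (λ _ → bounded)) (*-monoˡ-≤ (2 + B) S≤k)
    where
    R : Fin n → Fin n × Fin n → Set
    R x (s , t) = γ w s t ≢ 0 × x ∈ s ∷ t ∷ thirds w s t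
    via : ∀ {x s t} → S ∋ s ─ t × γ w s t ≢ 0 → x ∈ s ∷ t ∷ thirds w s t → Any (R x) (pairs S)
    via {x} {s} {t} (h , e) i with orient S h
    ... | inj₁ j = Any.map (λ { refl → e , i }) j
    ... | inj₂ j = Any.map (λ { refl → subst (_≢ 0) (γ-sym w s t) e , turn i }) j
      where
      turn : x ∈ s ∷ t ∷ thirds w s t → x ∈ t ∷ s ∷ thirds w t s
      turn (here refl)         = there (here refl)
      turn (there (here refl)) = here refl
      turn (there (there l))   = there (there (subst (x ∈_) (thirds-sym w s t) l))
    covered : ∀ {x} → Affected x → Any (R x) (pairs S)
    covered (u , v , p) with hit w S free p
    ... | inj₁ h        = via h (here refl)
    ... | inj₂ (inj₁ h) = via h (there (there (∈-thirds⁺ w (P₃-rotate w p))))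
    ... | inj₂ (inj₂ h) = via h (here refl)
    bounded : ∀ {q} zs → Unique zs → All (λ z → R z q) zs → length zs ≤ 2 + B
    bounded []       _ _              = z≤n
    bounded {s , t} (z ∷ zs) u rs@((e , _) ∷ _) =
      ≤-trans (length-⊆ (z ∷ zs) (s ∷ t ∷ thirds w s t) u (proj₂ ∘ All.lookup rs)) (s≤s (s≤s (few e)))

-- K is the image of ι. To lift a solution on K to w, keep only its pairs both
-- of whose ends have all their neighbours in K. Suppose that a path a, b, c
-- with ac deleted arises, and that b has a neighbour y outside of K; then b is
-- not affected, so y is adjacent to a or c, contradicting the choice of ac.
module Restrict {n n′} (w : Weight n) (ι : Fin n′ → Fin n)
  (ι-mono : ∀ {u v} → u Fin.< v → ι u Fin.< ι v)
  (ι-inj : ∀ {u v} → ι u ≡ ι v → u ≡ v) where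

  pullback : Weight n′
  pullback = record
    { γ     = λ u v → γ w (ι u) (ι v)
    ; γ-sym = λ u v → γ-sym w (ι u) (ι v)
    ; γ-irr = λ u → γ-irr w (ι u)
    ; value = λ u v → value w (ι u) (ι v)
    }

  solvable-pullback⁺ : ∀ {k} → Solvable w k → Solvable pullback k
  solvable-pullback⁺ {k} (S , S≤k , free) = S′ , ≤-trans (inject R (pairs S′) (pairs S) (pairs-unique S′) covered injective) S≤k ,
    λ u v x → free (ι u) (ι v) (ι x)
    where
    S′ : EdgeSet n′
    S′ = record
      { has       = λ u v → has S (ι u) (ι v)
      ; symmetric = λ u v → symmetric S (ι u) (ι v)
      ; loopless  = λ u → loopless S (ι u)
      }
    R : Fin n′ × Fin n′ → Fin n × Fin n → Set
    R (u , v) q = (ι u , ι v) ≡ q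
    covered : ∀ {q} → q ∈ pairs S′ → ∃[ r ] (r ∈ pairs S × R q r)
    covered i = let u<v , h = ∈-pairs⁻ S′ i in _ , ∈-pairs⁺ S (ι-mono u<v) h , refl
    injective : ∀ {q q′ r} → R q r → R q′ r → q ≡ q′
    injective e e′ with eq ← trans e (sym e′) = cong₂ _,_ (ι-inj (cong proj₁ eq)) (ι-inj (cong proj₂ eq))

  Kept : Fin n → Set
  Kept x = ∃[ u ] ι u ≡ x

  Interior : Fin n → Set
  Interior x = Kept x × (∀ y → γ w x y ≢ 0 → Kept y)

  kept? : ∀ x → Dec (Kept x)
  kept? x = any? (λ u → ι u Fin.≟ x)

  interior? : ∀ x → Dec (Interior x)
  interior? x = kept? x ×-dec all? (λ y → ¬? (γ w x y ≟ 0) →-dec kept? y)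

  solvable-pullback⁻ : (∀ {x y} → Affected w x → γ w x y ≢ 0 → Kept x × Kept y) →
    ∀ {k} → Solvable pullback k → Solvable w k
  solvable-pullback⁻ closed {k} (S , S≤k , free) =
    S⁺ , ≤-trans (inject R (pairs S⁺) (pairs S) (pairs-unique S⁺) covered injective) S≤k , free⁺
    where
    Lifts : Fin n → Fin n → Fin n′ → Fin n′ → Set
    Lifts x y u v = ι u ≡ x × ι v ≡ y × S ∋ u ─ v
    P : Fin n → Fin n → Set
    P x y = Interior x × Interior y × ∃[ u ] ∃[ v ] Lifts x y u v
    S⁺ : EdgeSet n
    S⁺ = edgeSet P
      (λ x y → interior? x ×-dec interior? y ×-dec any? λ u → any? λ v →
        (ι u Fin.≟ x) ×-dec (ι v Fin.≟ y) ×-dec T? (has S u v))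
      (λ (i , j , u , v , e , f , h) → j , i , v , u , f , e , swap-edge S h)
      (λ (_ , _ , u , v , e , f , h) → not-loop S (subst (λ x → S ∋ u ─ x) (ι-inj (trans f (sym e))) h))
    R : Fin n × Fin n → Fin n′ × Fin n′ → Set
    R q (u , v) = (ι u , ι v) ≡ q
    injective : ∀ {q q′ r} → R q r → R q′ r → q ≡ q′
    injective refl refl = refl
    covered : ∀ {q} → q ∈ pairs S⁺ → ∃[ r ] (r ∈ pairs S × R q r)
    covered i with x<y , h ← ∈-pairs⁻ S⁺ i | toWitness (proj₂ (∈-pairs⁻ S⁺ i))
    ... | _ , _ , u , v , refl , refl , g with orient S g
    ...   | inj₁ j = (u , v) , j , refl
    ...   | inj₂ j = contradiction x<y (Fin.<-asym (ι-mono (proj₁ (∈-pairs⁻ S j))))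
    kept-edge : ∀ {u v} → Interior (ι u) → Interior (ι v) → γ (mask w S⁺) (ι u) (ι v) ≢ 0 →
      γ (mask pullback S) u v ≡ γ (mask w S⁺) (ι u) (ι v)
    kept-edge {u} {v} i j e = trans (mask-false pullback S ¬S) (sym (mask-false w S⁺ ¬S⁺))
      where
      ¬S⁺ : ¬ S⁺ ∋ ι u ─ ι v
      ¬S⁺ h = e (mask-true w S⁺ h)
      ¬S : ¬ S ∋ u ─ v
      ¬S h = ¬S⁺ (fromWitness (i , j , u , v , refl , refl , h))
    nonzero : ∀ {x m} → x ≡ suc m → x ≢ 0
    nonzero refl ()
    original : ∀ {x y m} → γ (mask w S⁺) x y ≡ suc m → γ w x y ≡ suc m
    original {x} {y} e = trans (sym (mask-false w S⁺ λ h → nonzero e (mask-true w S⁺ h))) e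
    affected-interior : ∀ {x} → Affected w x → ∀ {y} → γ w x y ≢ 0 → Interior x
    affected-interior a e = proj₁ (closed a e) , λ y e → proj₂ (closed a e)
    contra : ∀ {a b c} → Interior a → Interior b → Interior c →
      γ (mask w S⁺) a b ≡ 1 → γ (mask w S⁺) b c ≡ 3 → (∀ {u v} → ι u ≡ a → ι v ≡ c → γ (mask pullback S) u v ≡ 0) → ⊥
    contra i@((u , refl) , _) j@((v , refl) , _) l@((x , refl) , _) ab bc ac = free u v x
      (cong₂ _+_ (cong₂ _+_ (trans (kept-edge i j (nonzero ab)) ab) (trans (kept-edge j l (nonzero bc)) bc)) (ac refl refl))
    deleted : ∀ {a c} → S⁺ ∋ a ─ c → ∀ {u v} → ι u ≡ a → ι v ≡ c → γ (mask pullback S) u v ≡ 0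
    deleted h refl refl with _ , _ , u , v , e , f , g ← toWitness h | ι-inj e | ι-inj f
    ... | refl | refl = mask-true pullback S g
    free⁺ : Free (mask w S⁺)
    free⁺ x y z p with a , b , c , ab , bc , ac ← P₃-path (mask w S⁺) p | mask-cases w S⁺ a c
    ... | inj₁ same = contra (affected-interior (b , c , q) (nonzero (original ab)))
        (affected-interior (c , a , P₃-rotate w q) (nonzero (original bc)))
        (affected-interior (a , b , P₃-rotate w (P₃-rotate w q)) (nonzero (trans (γ-sym w c b) (original bc))))
        ab bc λ { {u} {v} refl refl → zero-mask (trans (sym same) ac) }
      where
      q : P₃ w a b c
      q = cong₂ _+_ (cong₂ _+_ (original ab) (original bc)) (trans (sym same) ac)
      zero-mask : ∀ {u v} → γ w (ι u) (ι v) ≡ 0 → γ (mask pullback S) u v ≡ 0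
      zero-mask {u} {v} e with has S u v
      ... | true  = refl
      ... | false = e
    ... | inj₂ (h , ac≢0) = decide (interior? b)
      where
      Ia : Interior a
      Ia = proj₁ (toWitness h)
      Ic : Interior c
      Ic = proj₁ (proj₂ (toWitness h))
      outside : ∀ y → γ w b y ≢ 0 → ¬ ¬ Kept y
      outside y by ¬y with γ w b y in eq | value w b y
      ... | _ | none  = by refl
      ... | _ | blue₃ = ¬y (proj₂ Ia y λ ay → ¬y (proj₂ (closed (y , a , P₃-rotate w (cong₂ _+_ (cong₂ _+_ (original ab) eq) ay)) (nonzero eq))))
      ... | _ | red₁  = ¬y (proj₂ Ic y λ cy → ¬y (proj₂ (closed (y , c , P₃-rotate w (cong₂ _+_ (cong₂ _+_ (trans (γ-sym w c b) (original bc)) eq) cy)) (nonzero eq))))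
      decide : Dec (Interior b) → ⊥
      decide (yes i) = contra Ia i Ic ab bc (deleted h)
      decide (no ¬i) = ¬i (proj₂ Ia b (nonzero (original ab)) , λ y by → decidable-stable (kept? y) (outside y by))

code-zero : ∀ a b → code a b ≡ 0 → ¬ T (a ∨ b)
code-zero false false _ ()

code-nonzero : ∀ a b → code a b ≢ 0 → T (a ∨ b)
code-nonzero true  _     _ = _
code-nonzero false true  _ = _
code-nonzero false false h = contradiction refl h

code-one : ∀ a b → code a b ≡ 1 → T a
code-one true _ _ = _
code-one false true ()
code-one false false ()

code-three : ∀ a b → code a b ≡ 3 → T b
code-three true _ ()
code-three false true _ = _

T⇒code-one : ∀ a b → T a → code a b ≡ 1
T⇒code-one true _ _ = refl

T⇒code-three : ∀ a b → ¬ T a → T b → code a b ≡ 3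
T⇒code-three true  b    h _ = contradiction _ h
T⇒code-three false true _ _ = refl

¬T⇒code-zero : ∀ a b → ¬ T (a ∨ b) → code a b ≡ 0
¬T⇒code-zero true  _     h = contradiction _ h
¬T⇒code-zero false true  h = contradiction _ h
¬T⇒code-zero false false _ = refl

module _ (G : TwoColoredGraph) where

  γ-red : ∀ {u v} → Eᵣ G ∋ u ─ v → γ (graphWeight G) u v ≡ 1
  γ-red {u} {v} = T⇒code-one (has (Eᵣ G) u v) (has (Eᵇ G) u v)

  γ-blue : ∀ {u v} → Eᵇ G ∋ u ─ v → γ (graphWeight G) u v ≡ 3
  γ-blue {u} {v} b = T⇒code-three (has (Eᵣ G) u v) (has (Eᵇ G) u v) (λ r → disjoint G u v r b) b

  γ-edge : ∀ {u v} → γ (graphWeight G) u v ≢ 0 → E G ∋ u ─ v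
  γ-edge {u} {v} = code-nonzero (has (Eᵣ G) u v) (has (Eᵇ G) u v)

  free⇒P₃-free : Free (graphWeight G) → BicoloredP₃-Free G
  free⇒P₃-free free u v x (r , b , ¬e) = free u v x (cong₂ _+_ (cong₂ _+_ (γ-red r) (γ-blue b))
    (¬T⇒code-zero (has (Eᵣ G) u x) (has (Eᵇ G) u x) ¬e))

  P₃-free⇒free : BicoloredP₃-Free G → Free (graphWeight G)
  P₃-free⇒free free u v x p with a , b , c , ab , bc , ac ← P₃-path (graphWeight G) p =
    free a b c (code-one _ (has (Eᵇ G) a b) ab , code-three (has (Eᵣ G) b c) _ bc ,
      code-zero (has (Eᵣ G) a c) (has (Eᵇ G) a c) ac)

module _ (G : TwoColoredGraph) where

  deletion-weight : ∀ S u v → γ (graphWeight (G ─ S)) u v ≡ γ (mask (graphWeight G) S) u v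
  deletion-weight S u v with has (Eᵣ G) u v | has (Eᵇ G) u v | has S u v
  ... | true  | _     | true  = code-∧-false _
    where
    code-∧-false : ∀ b → code false (b ∧ false) ≡ 0
    code-∧-false true  = refl
    code-∧-false false = refl
  ... | true  | _     | false = refl
  ... | false | true  | true  = refl
  ... | false | true  | false = refl
  ... | false | false | true  = refl
  ... | false | false | false = refl

  solvable⇒yes : ∀ {k} → Solvable (graphWeight G) k → YesInstance ⟨ G , k ⟩
  solvable⇒yes {k} (S , S≤k , free) = S′ , (λ u v h → proj₁ (Equivalence.to (T-∧ {has (E G) u v}) h)) ,
    ≤-trans (length-⊆ _ _ (pairs-unique S′) within) S≤k ,
    free⇒P₃-free (G ─ S′) (Free-cong (mask (graphWeight G) S) (graphWeight (G ─ S′)) same free)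
    where
    S′ : EdgeSet (order G)
    S′ = record
      { has       = λ u v → has (E G) u v ∧ has S u v
      ; symmetric = λ u v → cong₂ _∧_ (symmetric (E G) u v) (symmetric S u v)
      ; loopless  = λ u → cong (_∧ has S u u) (loopless (E G) u)
      }
    within : ∀ {q} → q ∈ pairs S′ → q ∈ pairs S
    within {u , v} i = let u<v , h = ∈-pairs⁻ S′ i in
      ∈-pairs⁺ S u<v (proj₂ (Equivalence.to (T-∧ {has (E G) u v}) h))
    same-mask : ∀ u v → γ (mask (graphWeight G) S) u v ≡ γ (mask (graphWeight G) S′) u v
    same-mask u v with has (Eᵣ G) u v | has (Eᵇ G) u v | has S u v
    ... | true  | _     | true  = refl
    ... | true  | _     | false = refl
    ... | false | true  | true  = refl
    ... | false | true  | false = refl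
    ... | false | false | true  = refl
    ... | false | false | false = refl
    same : ∀ u v → γ (mask (graphWeight G) S) u v ≡ γ (graphWeight (G ─ S′)) u v
    same u v = trans (same-mask u v) (sym (deletion-weight S′ u v))

  yes⇒solvable : ∀ {k} → YesInstance ⟨ G , k ⟩ → Solvable (graphWeight G) k
  yes⇒solvable (S , _ , S≤k , free) = S , S≤k ,
    Free-cong (graphWeight (G ─ S)) (mask (graphWeight G) S) (deletion-weight S) (P₃-free⇒free (G ─ S) free)

  deleting-all : ∀ {k} → card (E G) ≤ k → YesInstance ⟨ G , k ⟩
  deleting-all E≤k = E G , (λ _ _ h → h) , E≤k ,
    λ u v w (r , _) → absurd (has (Eᵣ G) u v) (has (Eᵇ G) u v) r
    where
    absurd : ∀ a b → ¬ T (a ∧ not (a ∨ b))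
    absurd true _ ()

  degree≤Δ : ∀ v → degree G v ≤ Δ G
  degree≤Δ v = All.lookup (xs≤max 0 (map (degree G) (allFin (order G)))) (∈-map⁺ (degree G) (∈-allFin v))

  adjacent : Vertex G → List (Vertex G)
  adjacent v = elements (neighbours G v)

  adjacent≤Δ : ∀ v → length (adjacent v) ≤ Δ G
  adjacent≤Δ v = subst (_≤ Δ G) (sym (length-elements (neighbours G v))) (degree≤Δ v)

  ∈-adjacent : ∀ {u v} → E G ∋ u ─ v → v ∈ adjacent u
  ∈-adjacent {u} {v} = ∈-elements (has (E G) u) v

  1≤Δ : ∀ {u v} → E G ∋ u ─ v → 1 ≤ Δ G
  1≤Δ {u} h = ≤-trans (nonempty (∈-adjacent h)) (adjacent≤Δ u)
    where
    nonempty : ∀ {A : Set} {x : A} {xs} → x ∈ xs → 1 ≤ length xs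
    nonempty {xs = _ ∷ _} _ = s≤s z≤n

  module _ (w : Weight (order G)) (w⊆E : ∀ {u v} → γ w u v ≢ 0 → E G ∋ u ─ v) where

    thirds≤2Δ : ∀ {u v} → γ w u v ≢ 0 → length (thirds w u v) ≤ Δ G + Δ G
    thirds≤2Δ {u} {v} uv≢0 = ≤-trans (length-⊆ (thirds w u v) (adjacent v ++ adjacent u) (thirds-unique w u v) within)
      (subst (_≤ Δ G + Δ G) (sym (length-++ (adjacent v))) (+-mono-≤ (adjacent≤Δ v) (adjacent≤Δ u)))
      where
      within : ∀ {x} → x ∈ thirds w u v → x ∈ adjacent v ++ adjacent u
      within {x} i with ∈-thirds⁻ w {u} {v} i
      ... | p with γ w v x in vx | γ w u x in ux
      ...   | suc _ | _     = ∈-++⁺ˡ (∈-adjacent (w⊆E λ e → contradiction (trans (sym vx) e) λ ()))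
      ...   | zero  | suc _ = ∈-++⁺ʳ (adjacent v) (∈-adjacent (w⊆E λ e → contradiction (trans (sym ux) e) λ ()))
      ...   | zero  | zero  with γ w u v | value w u v | p
      ...     | _ | none  | ()
      ...     | _ | red₁  | ()
      ...     | _ | blue₃ | ()

  neighbourhood-bound : ∀ as xs → Unique xs →
    (∀ {x} → x ∈ xs → ∃[ a ] (a ∈ as × (x ≡ a ⊎ E G ∋ a ─ x))) → length xs ≤ length as * (1 + Δ G)
  neighbourhood-bound as xs unique near = cover R as xs unique
    (λ i → let a , a∈ , h = near i in Any.map (λ { refl → h }) a∈) (λ _ → bounded)
    where
    R : Vertex G → Vertex G → Set
    R x a = x ≡ a ⊎ E G ∋ a ─ x
    bounded : ∀ {a} zs → Unique zs → All (λ z → R z a) zs → length zs ≤ 1 + Δ G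
    bounded {a} zs u rs = ≤-trans (length-⊆ zs (a ∷ adjacent a) u within) (s≤s (adjacent≤Δ a))
      where
      within : ∀ {z} → z ∈ zs → z ∈ a ∷ adjacent a
      within i with All.lookup rs i
      ... | inj₁ refl = here refl
      ... | inj₂ h    = there (∈-adjacent h)

module _ (G : TwoColoredGraph) (F : EdgeSet (order G)) {n′} (ι : Fin n′ → Vertex G)
  (ι-mono : ∀ {u v} → u Fin.< v → ι u Fin.< ι v) (ι-inj : ∀ {u v} → ι u ≡ ι v → u ≡ v) where

  inducedEdges : EdgeSet (order G) → EdgeSet n′
  inducedEdges A = record
    { has       = λ u v → has A (ι u) (ι v)
    ; symmetric = λ u v → symmetric A (ι u) (ι v)
    ; loopless  = λ u → loopless A (ι u)
    }

  induced : TwoColoredGraph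
  induced = record
    { order    = n′
    ; Eᵣ       = inducedEdges (Eᵣ G ∖ᴱ F)
    ; Eᵇ       = inducedEdges (Eᵇ G ∖ᴱ F)
    ; disjoint = λ u v → disjoint (G ─ F) (ι u) (ι v)
    }

  open Restrict (mask (graphWeight G) F) ι ι-mono ι-inj

  solvable-cong : ∀ {n k} (w w′ : Weight n) → (∀ u v → γ w u v ≡ γ w′ u v) → Solvable w k → Solvable w′ k
  solvable-cong w w′ eq (S , S≤k , free) = S , S≤k ,
    Free-cong (mask w S) (mask w′ S) (λ u v → cong (λ x → if has S u v then 0 else x) (eq u v)) free

  yes-induced⁺ : ∀ {k} → Solvable (mask (graphWeight G) F) k → YesInstance ⟨ induced , k ⟩
  yes-induced⁺ h = solvable⇒yes induced (solvable-cong pullback (graphWeight induced)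
    (λ u v → sym (deletion-weight G F (ι u) (ι v))) (solvable-pullback⁺ h))

  yes-induced⁻ : (∀ {x y} → Affected (mask (graphWeight G) F) x → γ (mask (graphWeight G) F) x y ≢ 0 → Kept x × Kept y) →
    ∀ {k} → YesInstance ⟨ induced , k ⟩ → Solvable (mask (graphWeight G) F) k
  yes-induced⁻ closed h = solvable-pullback⁻ closed (solvable-cong (graphWeight induced) pullback
    (λ u v → deletion-weight G F (ι u) (ι v)) (yes⇒solvable induced h))

-- Passes of the program

loop-inductionᶠ : ∀ {c p σ n} (P : ℕ → State → Set) →
  P 0 (loop c p σ 0) →
  (∀ (x : Fin n) → P (toℕ x) (loop c p σ (toℕ x)) → P (suc (toℕ x)) (loop c p σ (suc (toℕ x)))) →
  P n (loop c p σ n)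
loop-inductionᶠ {c} {p} {σ} P base step = loop-induction {c} {p} {σ} P base λ i i<n →
  subst (λ i → P i (loop c p σ i) → P (suc i) (loop c p σ (suc i))) (toℕ-fromℕ< i<n) (step (fromℕ< i<n))

when-yes : ∀ e p σ → ⟦ e ⟧ σ ≢ 0 → run (WHEN e THEN p) σ ≡ run p σ
when-yes e p σ h with ⟦ e ⟧ σ
... | zero  = contradiction refl h
... | suc _ = refl

when-no : ∀ e p σ → ⟦ e ⟧ σ ≡ 0 → run (WHEN e THEN p) σ ≡ σ
when-no e p σ h with ⟦ e ⟧ σ
... | zero  = refl

read-cases : ∀ σ a i j x → (i ≡ j × (σ [ a , i ↦ x ]) a j ≡ x) ⊎ (i ≢ j × (σ [ a , i ↦ x ]) a j ≡ σ a j)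
read-cases σ a i j x = go (i ≟ j)
  where
  go : Dec (i ≡ j) → (i ≡ j × (σ [ a , i ↦ x ]) a j ≡ x) ⊎ (i ≢ j × (σ [ a , i ↦ x ]) a j ≡ σ a j)
  go (yes refl) = inj₁ (refl , read-same σ a i x)
  go (no i≢j)   = inj₂ (i≢j , read-other σ a x i≢j)

Sum : (ℕ → ℕ) → ℕ → ℕ
Sum g zero    = 0
Sum g (suc x) = Sum g x + g x

here₄ : Exp
here₄ = 4 [ lit 0 ]

-- Writing arrays as 6 + y or 9 + M makes their comparison with the smaller
-- array numbers compute, so that most frame conditions hold definitionally.
module Prefix (y q : ℕ) (y≢q : T (not (y ≡ᵇ q))) (e : Exp) where

  prefix-body : Code
  prefix-body = (6 + y) [ here₄ ]:= (6 + q) [ lit 0 ] ▸ (6 + q) [ lit 0 ]:= (6 + q) [ lit 0 ] ⊕ e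

  prefix : Code
  prefix = FOR 4 < 0 DO prefix-body

  prefix-spec : ∀ {σ n} (g : ℕ → ℕ) → σ 0 0 ≡ n → σ (6 + q) 0 ≡ 0 →
    (∀ (x : Fin n) τ → (∀ b → T (keeps b prefix) → ∀ z → τ b z ≡ σ b z) → τ 4 0 ≡ toℕ x → ⟦ e ⟧ τ ≡ g (toℕ x)) →
    (∀ x → x < n → run prefix σ (6 + y) x ≡ Sum g x) × run prefix σ (6 + q) 0 ≡ Sum g n
  prefix-spec {σ} {n} g n-at blank eval rewrite n-at = loop-inductionᶠ {4} {prefix-body} {σ} P ((λ _ ()) , blank) step
    where
    P : ℕ → State → Set
    P i τ = (∀ x → x < i → τ (6 + y) x ≡ Sum g x) × τ (6 + q) 0 ≡ Sum g i
    step : ∀ x → P (toℕ x) (loop 4 prefix-body σ (toℕ x)) → P (suc (toℕ x)) (loop 4 prefix-body σ (suc (toℕ x)))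
    step x (old , acc) = new , sum
      where
      τ τ₁ : State
      τ = loop 4 prefix-body σ (toℕ x)
      τ₁ = τ [ 6 + y , τ 4 0 ↦ τ (6 + q) 0 ]
      y≢ : 6 + y ≢ 6 + q
      y≢ eq = ≢ᵇ⇒≢ y q y≢q (+-cancelˡ-≡ 6 y q eq)
      q-read : τ₁ (6 + q) 0 ≡ Sum g (toℕ x)
      q-read = trans (read-array τ (τ 4 0) 0 (τ (6 + q) 0) y≢) acc
      e-read : ⟦ e ⟧ τ₁ ≡ g (toℕ x)
      e-read = eval x τ₁ (λ b h z → trans
          (read-array τ (τ 4 0) z (τ (6 + q) 0) (≢-sym (≢ᵇ⇒≢ b (6 + y) (∧-fst (∧-snd {not (b ≡ᵇ 4)} h)))))
          (frame-loop 4 prefix-body (∧-snd {not (b ≡ᵇ 4)} h) (∧-fst h) σ (toℕ x) z))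
        (counter 4 prefix-body σ (toℕ x))
      sum : (τ₁ [ 6 + q , 0 ↦ τ₁ (6 + q) 0 + ⟦ e ⟧ τ₁ ]) (6 + q) 0 ≡ Sum g (suc (toℕ x))
      sum = trans (read-same τ₁ (6 + q) 0 (τ₁ (6 + q) 0 + ⟦ e ⟧ τ₁)) (cong₂ _+_ q-read e-read)
      new : ∀ z → z < suc (toℕ x) → (τ₁ [ 6 + q , 0 ↦ τ₁ (6 + q) 0 + ⟦ e ⟧ τ₁ ]) (6 + y) z ≡ Sum g z
      new z z≤x rewrite read-array τ₁ 0 z (τ₁ (6 + q) 0 + ⟦ e ⟧ τ₁) (≢-sym y≢)
        with read-cases τ (6 + y) (τ 4 0) z (τ (6 + q) 0)
      ... | inj₁ (refl , eq) = trans eq (trans acc (cong (Sum g) (sym (counter 4 prefix-body σ (toℕ x)))))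
      ... | inj₂ (≢z , eq)   = trans eq (old z (≤∧≢⇒< (≤-pred z≤x) λ z≡ → ≢z (trans (counter 4 prefix-body σ (toℕ x)) (sym z≡))))

at : ∀ {n} → Fin n → Fin n → ℕ
at {n} u v = toℕ u * n + toℕ v

at-injective : ∀ {n} {u v u′ v′ : Fin n} → at u v ≡ at u′ v′ → u ≡ u′ × v ≡ v′
at-injective {n} {u} {v} {u′} {v′} eq = combine-injective u v u′ v′ (toℕ-injective (trans (combine≡at u v) (trans eq (sym (combine≡at u′ v′)))))
  where
  combine≡at : ∀ u v → toℕ (combine u v) ≡ at u v
  combine≡at u v = trans (toℕ-combine u v) (cong (_+ toℕ v) (*-comm n (toℕ u)))

cell : Exp → Exp → Exp
cell u v = 6 [ u ] ⊕ v

unflagged : ℕ → Exp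
unflagged D = lit 1 ⊖ D [ here₄ ]

put-edge : ℕ → Code
put-edge M =
  M [ cell (1 [ here₄ ]) (2 [ here₄ ]) ]:= lit 1 ⊕ 3 [ here₄ ] ⊕ 3 [ here₄ ] ▸
  M [ cell (2 [ here₄ ]) (1 [ here₄ ]) ]:= lit 1 ⊕ 3 [ here₄ ] ⊕ 3 [ here₄ ]

fill-body fill : ℕ → ℕ → Code
fill-body D M = WHEN unflagged D THEN put-edge M
fill D M = FOR 4 < 1 DO fill-body D M

is-four : Exp → Exp
is-four e = lit 1 ⊖ ((e ⊖ lit 4) ⊕ (lit 4 ⊖ e))

is-four-yes : ∀ {x} → x ≡ 4 → 1 ∸ ((x ∸ 4) + (4 ∸ x)) ≢ 0
is-four-yes refl ()

is-four-no : ∀ x → x ≢ 4 → 1 ∸ ((x ∸ 4) + (4 ∸ x)) ≡ 0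
is-four-no 0 _ = refl
is-four-no 1 _ = refl
is-four-no 2 _ = refl
is-four-no 3 _ = refl
is-four-no 4 h = contradiction refl h
is-four-no (suc (suc (suc (suc (suc x))))) _ = 0∸n≡0 (x + 0)

triple : ℕ → Exp
triple M = M [ cell (1 [ here₄ ]) (2 [ here₄ ]) ]
         ⊕ M [ cell (2 [ here₄ ]) (5 [ lit 0 ]) ]
         ⊕ M [ cell (1 [ here₄ ]) (5 [ lit 0 ]) ]

bump : ℕ → Code
bump C = C [ here₄ ]:= C [ here₄ ] ⊕ lit 1

tally-inner : ℕ → ℕ → Code
tally-inner M C = WHEN is-four (triple M) THEN bump C

tally-body tally : ℕ → ℕ → ℕ → Code
tally-body D M C = WHEN unflagged D THEN FOR 5 < 0 DO tally-inner M C
tally D M C = FOR 4 < 1 DO tally-body D M C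

raise flag-body flag : Code
raise = 11 [ here₄ ]:= lit 1 ▸ 12 [ lit 0 ]:= 12 [ lit 0 ] ⊕ lit 1
flag-body = WHEN 10 [ here₄ ] ⊖ 0 [ lit 2 ] THEN raise
flag = FOR 4 < 1 DO flag-body

maximise-body maximise : Code
maximise-body = 15 [ lit 0 ]:= 14 [ here₄ ] ⊕ (15 [ lit 0 ] ⊖ 14 [ here₄ ])
maximise = FOR 4 < 1 DO maximise-body

put-marks : ℕ → Code
put-marks X = X [ 1 [ here₄ ] ]:= lit 1 ▸ X [ 2 [ here₄ ] ]:= lit 1

mark-body mark : Exp → ℕ → Code
mark-body e X = WHEN e THEN put-marks X
mark e X = FOR 4 < 1 DO mark-body e X

shrink-body shrink : Code
shrink-body = 18 [ lit 0 ]:= 18 [ lit 0 ] ⊖ (lit 2 ⊕ 15 [ lit 0 ])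
shrink = FOR 4 < 2 DO shrink-body

shrink-spec : ∀ {σ k} → σ 0 2 ≡ k → run shrink σ 18 0 ≡ σ 18 0 ∸ k * (2 + σ 15 0)
shrink-spec {σ} {k} k-at rewrite k-at = loop-induction {4} {shrink-body} {σ} {k} P refl λ i _ → step i
  where
  P : ℕ → State → Set
  P i τ = τ 18 0 ≡ σ 18 0 ∸ i * (2 + σ 15 0)
  step : ∀ i → P i (loop 4 shrink-body σ i) → P (suc i) (loop 4 shrink-body σ (suc i))
  step i e = begin
    τ 18 0 ∸ (2 + τ 15 0)                              ≡⟨ cong₂ _∸_ e (cong (2 +_) (frame-loop 4 shrink-body _ _ σ i 0)) ⟩
    σ 18 0 ∸ i * (2 + σ 15 0) ∸ (2 + σ 15 0)           ≡⟨ ∸-+-assoc (σ 18 0) (i * (2 + σ 15 0)) (2 + σ 15 0) ⟩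
    σ 18 0 ∸ (i * (2 + σ 15 0) + (2 + σ 15 0))         ≡⟨ cong (σ 18 0 ∸_) (+-comm (i * (2 + σ 15 0)) (2 + σ 15 0)) ⟩
    σ 18 0 ∸ suc i * (2 + σ 15 0)                      ∎
    where
    open ≡-Reasoning
    τ : State
    τ = loop 4 shrink-body σ i

Sum-mono : ∀ g {x y} → x ≤ y → Sum g x ≤ Sum g y
Sum-mono g {x} {zero}  z≤n = ≤-refl
Sum-mono g {x} {suc y} x≤ with m≤n⇒m<n∨m≡n x≤
... | inj₁ x≤y  = ≤-trans (Sum-mono g (≤-pred x≤y)) (m≤m+n (Sum g y) (g y))
... | inj₂ refl = ≤-refl

Sum-const : ∀ c x → Sum (λ _ → c) x ≡ x * c
Sum-const c zero    = refl
Sum-const c (suc x) = trans (cong (_+ c) (Sum-const c x)) (+-comm (x * c) c)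

-- ι lists the positions below n at which a is 1; the rank of such a position
-- is the prefix sum of a.
module Enumerate (a : ℕ → ℕ) {n : ℕ} (bit : ∀ (v : Fin n) → a (toℕ v) ≡ 0 ⊎ a (toℕ v) ≡ 1) where

  total : ℕ
  total = Sum a n

  find : ∀ N → N ≤ n → ∀ i → i < Sum a N → ∃[ x ] (x < N × a x ≡ 1 × Sum a x ≡ i)
  find (suc N) N<n i i< with i <? Sum a N
  ... | yes i<′ = let x , x<N , r = find N (<⇒≤ N<n) i i<′ in x , m<n⇒m<1+n x<N , r
  ... | no i≮ with subst (λ N → a N ≡ 0 ⊎ a N ≡ 1) (toℕ-fromℕ< N<n) (bit (fromℕ< N<n))
  ...   | inj₁ z = contradiction (subst (i <_) (trans (cong (Sum a N +_) z) (+-identityʳ (Sum a N))) i<) i≮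
  ...   | inj₂ o = N , ≤-refl , o , ≤-antisym (≮⇒≥ i≮)
    (≤-pred (subst (i <_) (trans (cong (Sum a N +_) o) (+-comm (Sum a N) 1)) i<))

  ι : Fin total → Fin n
  ι u = fromℕ< (proj₁ (proj₂ (find n ≤-refl (toℕ u) (toℕ<n u))))

  toℕ-ι : ∀ u → toℕ (ι u) ≡ proj₁ (find n ≤-refl (toℕ u) (toℕ<n u))
  toℕ-ι u = toℕ-fromℕ< (proj₁ (proj₂ (find n ≤-refl (toℕ u) (toℕ<n u))))

  ι-one : ∀ u → a (toℕ (ι u)) ≡ 1
  ι-one u = trans (cong a (toℕ-ι u)) (proj₁ (proj₂ (proj₂ (find n ≤-refl (toℕ u) (toℕ<n u)))))

  rank-ι : ∀ u → Sum a (toℕ (ι u)) ≡ toℕ u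
  rank-ι u = trans (cong (Sum a) (toℕ-ι u)) (proj₂ (proj₂ (proj₂ (find n ≤-refl (toℕ u) (toℕ<n u)))))

  ι-mono : ∀ {u v} → u Fin.< v → ι u Fin.< ι v
  ι-mono {u} {v} u<v = ≰⇒> λ v≤u → <⇒≱ u<v (subst₂ _≤_ (rank-ι v) (rank-ι u) (Sum-mono a v≤u))

  ι-injective : ∀ {u v} → ι u ≡ ι v → u ≡ v
  ι-injective {u} {v} e = toℕ-injective (trans (sym (rank-ι u)) (trans (cong (Sum a ∘ toℕ) e) (rank-ι v)))

  Sum-strict : ∀ {x y} → a x ≡ 1 → x < y → Sum a x < Sum a y
  Sum-strict {x} {y} o x<y = ≤-trans (≤-reflexive (trans (+-comm 1 (Sum a x)) (cong (Sum a x +_) (sym o)))) (Sum-mono a x<y)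

  ι-onto : ∀ v → a (toℕ v) ≡ 1 → ∃[ u ] ι u ≡ v
  ι-onto v o = u , toℕ-injective (decide (<-cmp (toℕ (ι u)) (toℕ v)))
    where
    u : Fin total
    u = fromℕ< (Sum-strict o (toℕ<n v))
    same : Sum a (toℕ (ι u)) ≡ Sum a (toℕ v)
    same = trans (rank-ι u) (toℕ-fromℕ< (Sum-strict o (toℕ<n v)))
    decide : Tri (toℕ (ι u) < toℕ v) (toℕ (ι u) ≡ toℕ v) (toℕ v < toℕ (ι u)) → toℕ (ι u) ≡ toℕ v
    decide (tri< l _ _) = contradiction same (<⇒≢ (Sum-strict (ι-one u) l))
    decide (tri≈ _ e _) = e
    decide (tri> _ _ l) = contradiction (sym same) (<⇒≢ (Sum-strict o l))

  ones : List (Fin n)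
  ones = map ι (allFin total)

  ones-unique : Unique ones
  ones-unique = Unique.map⁺ ι-injective (Unique.allFin⁺ total)

  length-ones : length ones ≡ total
  length-ones = trans (length-map ι (allFin total)) (length-tabulate id)

  ∈-ones⁺ : ∀ {v} → a (toℕ v) ≡ 1 → v ∈ ones
  ∈-ones⁺ {v} o with u , refl ← ι-onto v o = ∈-map⁺ ι (∈-allFin u)

  ∈-ones⁻ : ∀ {v} → v ∈ ones → a (toℕ v) ≡ 1
  ∈-ones⁻ i with u , _ , refl ← ∈-map⁻ ι i = ι-one u

Stored : ∀ {n} → State → ℕ → List (ColoredEdge n) → Set
Stored σ i []       = ⊤
Stored σ i (e ∷ es) = (σ 1 i ≡ toℕ (src e) × σ 2 i ≡ toℕ (tgt e) × σ 3 i ≡ colorCode (color e)) × Stored σ (suc i) es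

Stored-lookup : ∀ {n} σ i (es : List (ColoredEdge n)) → Stored σ i es → ∀ x →
  σ 1 (i + toℕ x) ≡ toℕ (src (lookup es x)) × σ 2 (i + toℕ x) ≡ toℕ (tgt (lookup es x)) ×
  σ 3 (i + toℕ x) ≡ colorCode (color (lookup es x))
Stored-lookup σ i (e ∷ es) (h , _) Fin.zero rewrite +-identityʳ i = h
Stored-lookup σ i (e ∷ es) (_ , h) (Fin.suc x) rewrite +-suc i (toℕ x) = Stored-lookup σ (suc i) es h x

Stored-counter : ∀ {n} σ c i (es : List (ColoredEdge n)) → Stored σ i es → Stored (σ [ 4 , 0 ↦ c ]) i es
Stored-counter σ c i []       _       = _
Stored-counter σ c i (e ∷ es) (h , g) = h , Stored-counter σ c (suc i) es g

Stored-∷ʳ : ∀ {n} σ τ i (es : List (ColoredEdge n)) e → Stored σ i es →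
  (∀ z → z ≢ i + length es → τ 1 z ≡ σ 1 z × τ 2 z ≡ σ 2 z × τ 3 z ≡ σ 3 z) →
  τ 1 (i + length es) ≡ toℕ (src e) × τ 2 (i + length es) ≡ toℕ (tgt e) × τ 3 (i + length es) ≡ colorCode (color e) →
  Stored τ i (es ∷ʳ e)
Stored-∷ʳ σ τ i [] e _ _ new rewrite +-identityʳ i = new , _
Stored-∷ʳ σ τ i (e′ ∷ es) e ((a , b , c) , h) same new =
  (let a′ , b′ , c′ = same i (<⇒≢ (subst (i <_) (sym (+-suc i (length es))) (s≤s (m≤m+n i (length es))))) in trans a′ a , trans b′ b , trans c′ c) ,
  Stored-∷ʳ σ τ (suc i) es e h (λ z z≢ → same z (λ e → z≢ (trans e (+-suc i (length es)))))
    (subst (λ j → τ 1 j ≡ toℕ (src e) × τ 2 j ≡ toℕ (tgt e) × τ 3 j ≡ colorCode (color e)) (+-suc i (length es)) new)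

emit output-body output : Code
emit = 1 [ 22 [ lit 0 ] ]:= 20 [ 1 [ here₄ ] ] ▸
       2 [ 22 [ lit 0 ] ]:= 20 [ 2 [ here₄ ] ] ▸
       3 [ 22 [ lit 0 ] ]:= 3 [ here₄ ] ▸
       22 [ lit 0 ]:= 22 [ lit 0 ] ⊕ lit 1

both-kept : Exp
both-kept = ((19 [ 1 [ here₄ ] ] ⊕ 19 [ 2 [ here₄ ] ]) ⊖ lit 1) ⊖ 11 [ here₄ ]

output-body = WHEN both-kept THEN emit
output = FOR 4 < 1 DO output-body

-- Arrays: 4 and 5 loop counters; 6 row offsets of the matrices, 7 their running
-- sum; 8 no flags; 9 matrix of G, 10 thirds per edge in G; 11 flags of F,
-- 12 |F|; 13 matrix of H, 14 thirds per edge in H, 15 their maximum B;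
-- 16 affected vertices, 17 their ranks, 18 their number, then its excess over
-- k (2 + B); 19 kept vertices, 20 their ranks, 21 their number; 22 the number
-- of edges written.
offsets-code ranks-A ranks-K phase₁ phase₂ phase₃ : Code
offsets-code = Prefix.prefix 0 1 _ (0 [ lit 0 ])
ranks-A      = Prefix.prefix 11 12 _ (16 [ here₄ ])
ranks-K      = Prefix.prefix 14 15 _ (19 [ here₄ ])
phase₁ = offsets-code ▸ fill 8 9 ▸ tally 8 9 10 ▸ flag
phase₂ = fill 11 13 ▸ tally 11 13 14 ▸ maximise ▸ mark (14 [ here₄ ]) 16 ▸ ranks-A ▸ shrink
phase₃ = mark (16 [ 1 [ here₄ ] ] ⊕ 16 [ 2 [ here₄ ] ]) 19 ▸ ranks-K ▸ output

accept reject clear kernel kernel₂ kernel₃ : Program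
accept = 0 [ lit 0 ]≔ 21 [ lit 0 ] ⨾ 0 [ lit 1 ]≔ 22 [ lit 0 ] ⨾ 0 [ lit 2 ]≔ 0 [ lit 2 ] ⊖ 12 [ lit 0 ]
reject =
  1 [ lit 0 ]≔ lit 0 ⨾ 2 [ lit 0 ]≔ lit 1 ⨾ 3 [ lit 0 ]≔ lit 0 ⨾
  1 [ lit 1 ]≔ lit 1 ⨾ 2 [ lit 1 ]≔ lit 2 ⨾ 3 [ lit 1 ]≔ lit 1 ⨾
  0 [ lit 0 ]≔ lit 3 ⨾ 0 [ lit 1 ]≔ lit 2 ⨾ 0 [ lit 2 ]≔ lit 0
clear = 0 [ lit 0 ]≔ lit 0 ⨾ 0 [ lit 1 ]≔ lit 0
kernel₃ = IF 18 [ lit 0 ] THEN reject ELSE (compile phase₃ ⨾ accept)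
kernel₂ = IF 12 [ lit 0 ] ⊖ 0 [ lit 2 ] THEN reject ELSE (compile phase₂ ⨾ kernel₃)
kernel  = IF 0 [ lit 1 ] ⊖ 0 [ lit 2 ] THEN (compile phase₁ ⨾ kernel₂) ELSE clear

emptyGraph : TwoColoredGraph
emptyGraph = record
  { order    = 0
  ; Eᵣ       = record { has = λ () ; symmetric = λ () ; loopless = λ () }
  ; Eᵇ       = record { has = λ () ; symmetric = λ () ; loopless = λ () }
  ; disjoint = λ ()
  }

pathEdges : Color → EdgeSet 3
pathEdges c = record { has = h c ; symmetric = sy c ; loopless = lo c }
  where
  h : Color → Fin 3 → Fin 3 → Bool
  h red  0F 1F = true
  h red  1F 0F = true
  h blue 1F 2F = true
  h blue 2F 1F = true
  h _    _  _  = false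
  sy : ∀ c u v → h c u v ≡ h c v u
  sy red  0F 0F = refl
  sy red  0F 1F = refl
  sy red  0F 2F = refl
  sy red  1F 0F = refl
  sy red  1F 1F = refl
  sy red  1F 2F = refl
  sy red  2F 0F = refl
  sy red  2F 1F = refl
  sy red  2F 2F = refl
  sy blue 0F 0F = refl
  sy blue 0F 1F = refl
  sy blue 0F 2F = refl
  sy blue 1F 0F = refl
  sy blue 1F 1F = refl
  sy blue 1F 2F = refl
  sy blue 2F 0F = refl
  sy blue 2F 1F = refl
  sy blue 2F 2F = refl
  lo : ∀ c u → h c u u ≡ false
  lo red  0F = refl
  lo red  1F = refl
  lo red  2F = refl
  lo blue 0F = refl
  lo blue 1F = refl
  lo blue 2F = refl

path : TwoColoredGraph
path = record { order = 3 ; Eᵣ = pathEdges red ; Eᵇ = pathEdges blue ; disjoint = dis }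
  where
  dis : ∀ u v → pathEdges red ∋ u ─ v → ¬ pathEdges blue ∋ u ─ v
  dis 0F 1F _ ()
  dis 1F 0F _ ()

path-no : ¬ YesInstance ⟨ path , 0 ⟩
path-no (S , _ , S≤0 , free) = free 0F 1F 2F (kept 0F 1F , kept 1F 2F , λ ())
  where
  nonempty : ∀ {q} {qs : List (Fin 3 × Fin 3)} → q ∈ qs → ¬ length qs ≤ 0
  nonempty {qs = _ ∷ _} _ ()
  absent : ∀ u v → ¬ S ∋ u ─ v
  absent u v h with orient S h
  ... | inj₁ i = nonempty i S≤0
  ... | inj₂ i = nonempty i S≤0
  kept : ∀ u v → T (not (has S u v))
  kept u v with has S u v in eq
  ... | false = _
  ... | true  = absent u v (subst T (sym eq) _)

path-enumerated : (edge 0F 1F red ∷ edge 1F 2F blue ∷ []) Enumerates E[_] path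
path-enumerated = record
  { unique = ((λ ()) ∷ []) ∷ ([] ∷ [])
  ; exact  = mk⇔ to from
  }
  where
  to : ∀ {u v c} → edge u v c ∈ edge 0F 1F red ∷ edge 1F 2F blue ∷ [] → u Fin.< v × E[ path ] c ∋ u ─ v
  to (here refl)         = s≤s z≤n , _
  to (there (here refl)) = s≤s (s≤s z≤n) , _
  from : ∀ {u v c} → u Fin.< v × E[ path ] c ∋ u ─ v → edge u v c ∈ edge 0F 1F red ∷ edge 1F 2F blue ∷ []
  from {0F} {1F} {red}  _        = here refl
  from {1F} {0F} {red}  (() , _)
  from {1F} {2F} {blue} _        = there (here refl)
  from {2F} {1F} {blue} (s≤s () , _)
  from {0F} {0F} {red} (_ , ())
  from {0F} {2F} {red} (_ , ())
  from {1F} {1F} {red} (_ , ())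
  from {1F} {2F} {red} (_ , ())
  from {2F} {0F} {red} (_ , ())
  from {2F} {1F} {red} (_ , ())
  from {2F} {2F} {red} (_ , ())
  from {0F} {0F} {blue} (_ , ())
  from {0F} {1F} {blue} (_ , ())
  from {0F} {2F} {blue} (_ , ())
  from {1F} {0F} {blue} (_ , ())
  from {1F} {1F} {blue} (_ , ())
  from {2F} {0F} {blue} (_ , ())
  from {2F} {2F} {blue} (_ , ())

reject-run : ∀ σ → ∃[ σ′ ] (⟨ reject , σ ⟩⇓ σ′ within 27) × σ′ Encodes ⟨ path , 0 ⟩
reject-run σ = _ ,
  ⇓seq ⇓assign (⇓seq ⇓assign (⇓seq ⇓assign (⇓seq ⇓assign (⇓seq ⇓assign (⇓seq ⇓assign
    (⇓seq ⇓assign (⇓seq ⇓assign ⇓assign))))))) , record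
  { edges      = edge 0F 1F red ∷ edge 1F 2F blue ∷ []
  ; enumerates = path-enumerated
  ; n-stored   = refl
  ; m-stored   = refl
  ; k-stored   = refl
  ; src-stored = λ { 0F → refl ; 1F → refl }
  ; tgt-stored = λ { 0F → refl ; 1F → refl }
  ; col-stored = λ { 0F → refl ; 1F → refl }
  }

-- The conclusion of the theorem for the final segment p of the kernel, started
-- in σ.
Outcome : TwoColoredGraph → ℕ → Program → State → ℕ → Set
Outcome G k p σ X = ∃[ G′ ] ∃[ k′ ] ∃[ σ′ ] ∃[ t ]
  ( (⟨ p , σ ⟩⇓ σ′ within t)
  × (t ≤ X)
  × (σ′ Encodes ⟨ G′ , k′ ⟩)
  × (k′ ≤ k)
  × (YesInstance ⟨ G , k ⟩ ⇔ YesInstance ⟨ G′ , k′ ⟩)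
  × (order G′ ≤ 8 * (1 + k * Δ G * (k ⊓ Δ G))))

module Outcomes (G : TwoColoredGraph) (k : ℕ) where

  outcome-seq : ∀ {p q σ τ X Y} → (p , σ) ⇓ τ ≤ X → Outcome G k q τ Y → Outcome G k (p ⨾ q) σ (X + Y)
  outcome-seq (_ , d , s≤) (_ , _ , _ , _ , e , t≤ , rest) = _ , _ , _ , _ , ⇓seq d e , +-mono-≤ s≤ t≤ , rest

  outcome-then : ∀ {e p q σ X} → ⟦ e ⟧ σ ≢ 0 → Outcome G k p σ X → Outcome G k (IF e THEN p ELSE q) σ (cost e + X)
  outcome-then {e} h (_ , _ , _ , _ , d , t≤ , rest) = _ , _ , _ , _ , ⇓then h d , +-monoʳ-≤ (cost e) t≤ , rest

  outcome-else : ∀ {e p q σ X} → ⟦ e ⟧ σ ≡ 0 → Outcome G k q σ X → Outcome G k (IF e THEN p ELSE q) σ (cost e + X)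
  outcome-else {e} h (_ , _ , _ , _ , d , t≤ , rest) = _ , _ , _ , _ , ⇓else h d , +-monoʳ-≤ (cost e) t≤ , rest

  outcome-weaken : ∀ {p σ X Y} → X ≤ Y → Outcome G k p σ X → Outcome G k p σ Y
  outcome-weaken X≤Y (_ , _ , _ , _ , d , t≤ , rest) = _ , _ , _ , _ , d , ≤-trans t≤ X≤Y , rest

  outcome-reject : ∀ σ → ¬ YesInstance ⟨ G , k ⟩ → Outcome G k reject σ 27
  outcome-reject σ ¬G = let σ′ , d , enc = reject-run σ in
    path , 0 , σ′ , 27 , d , ≤-refl , enc , z≤n ,
    mk⇔ (λ y → contradiction y ¬G) (λ y → contradiction y path-no) ,
    ≤-trans (≤ᵇ⇒≤ 3 8 _) (m≤m*n 8 (1 + k * Δ G * (k ⊓ Δ G)))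

  outcome-clear : ∀ {σ} → σ 0 2 ≡ k → card (E G) ≤ k → Outcome G k clear σ 6
  outcome-clear {σ} k-at E≤k = emptyGraph , k , _ , 6 , ⇓seq ⇓assign ⇓assign , ≤-refl , record
      { edges      = []
      ; enumerates = record { unique = [] ; exact = λ {u} → contradiction u λ () }
      ; n-stored   = refl
      ; m-stored   = refl
      ; k-stored   = k-at
      ; src-stored = λ ()
      ; tgt-stored = λ ()
      ; col-stored = λ ()
      } , ≤-refl ,
    mk⇔ (λ _ → deleting-all emptyGraph z≤n) (λ _ → deleting-all G E≤k) , z≤n

size-bound : ∀ k B Δ μ → 1 ≤ Δ → B ≤ μ + μ → (1 ≤ k → 1 ≤ μ) → k * (2 + B) * (1 + Δ) ≤ 8 * (1 + k * Δ * μ)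
size-bound zero    B Δ μ 1≤Δ B≤ 1≤μ = z≤n
size-bound k@(suc _) B Δ μ 1≤Δ B≤ 1≤μ = begin
  k * (2 + B) * (1 + Δ)             ≤⟨ *-mono-≤ (*-monoʳ-≤ k (+-mono-≤ (+-mono-≤ (1≤μ (s≤s z≤n)) (1≤μ (s≤s z≤n))) B≤)) (+-monoˡ-≤ Δ 1≤Δ) ⟩
  k * (μ + μ + (μ + μ)) * (Δ + Δ)   ≡⟨ rearrange k μ Δ ⟩
  8 * (k * Δ * μ)                   ≤⟨ *-monoʳ-≤ 8 (n≤1+n (k * Δ * μ)) ⟩
  8 * (1 + k * Δ * μ)               ∎
  where
  open ≤-Reasoning
  rearrange : ∀ k μ Δ → k * (μ + μ + (μ + μ)) * (Δ + Δ) ≡ 8 * (k * Δ * μ)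
  rearrange = solve-∀

module Bounds (β : ℕ → ℕ) (X : ℕ) (1≤n : 1 ≤ β 0) (n≤X : β 0 * 1 ≤ X) (m≤X : β 1 * 1 ≤ X) (k≤X : β 2 * 1 ≤ X)
  (mn≤X : β 1 * β 0 ≤ X) where

  fits₁ : Fits phase₁ β X
  fits₁ = _ , (_ , _ , _ , 1 , ≤-refl , n≤X , _) ,
          _ , (_ , _ , _ , 1 , ≤-refl , m≤X , _) ,
          _ , (_ , _ , _ , β 0 , 1≤n , mn≤X , _ , _ , _ , 1 , ≤-refl , ≤-reflexive (*-identityʳ (β 0)) , _) ,
          (_ , _ , _ , 1 , ≤-refl , m≤X , _)

  fits₂ : Fits phase₂ β X
  fits₂ = _ , (_ , _ , _ , 1 , ≤-refl , m≤X , _) ,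
          _ , (_ , _ , _ , β 0 , 1≤n , mn≤X , _ , _ , _ , 1 , ≤-refl , ≤-reflexive (*-identityʳ (β 0)) , _) ,
          _ , (_ , _ , _ , 1 , ≤-refl , m≤X , _) ,
          _ , (_ , _ , _ , 1 , ≤-refl , m≤X , _) ,
          _ , (_ , _ , _ , 1 , ≤-refl , n≤X , _) ,
          (_ , _ , _ , 1 , ≤-refl , k≤X , _)

  fits₃ : Fits phase₃ β X
  fits₃ = _ , (_ , _ , _ , 1 , ≤-refl , m≤X , _) ,
          _ , (_ , _ , _ , 1 , ≤-refl , n≤X , _) ,
          (_ , _ , _ , 1 , ≤-refl , m≤X , _)

-- Correctness of the kernel

module Verified (G : TwoColoredGraph) (k : ℕ) (es : List (ColoredEdge (order G)))
  (enum : es Enumerates E[_] G) where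

  n m : ℕ
  n = order G
  m = length es

  s t : Fin m → Fin n
  s x = src (lookup es x)
  t x = tgt (lookup es x)

  record Loaded (σ : State) : Set where
    field
      n-at   : σ 0 0 ≡ n
      m-at   : σ 0 1 ≡ m
      k-at   : σ 0 2 ≡ k
      src-at : ∀ x → σ 1 (toℕ x) ≡ toℕ (s x)
      tgt-at : ∀ x → σ 2 (toℕ x) ≡ toℕ (t x)
      col-at : ∀ x → σ 3 (toℕ x) ≡ colorCode (color (lookup es x))

  open Loaded

  keepsInput : Code → Bool
  keepsInput p = keeps 0 p ∧ keeps 1 p ∧ keeps 2 p ∧ keeps 3 p

  transport : ∀ {σ τ} → (∀ x → τ 0 x ≡ σ 0 x) → (∀ x → τ 1 x ≡ σ 1 x) →
    (∀ x → τ 2 x ≡ σ 2 x) → (∀ x → τ 3 x ≡ σ 3 x) → Loaded σ → Loaded τ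
  transport e₀ e₁ e₂ e₃ L = record
    { n-at   = trans (e₀ 0) (n-at L)
    ; m-at   = trans (e₀ 1) (m-at L)
    ; k-at   = trans (e₀ 2) (k-at L)
    ; src-at = λ x → trans (e₁ (toℕ x)) (src-at L x)
    ; tgt-at = λ x → trans (e₂ (toℕ x)) (tgt-at L x)
    ; col-at = λ x → trans (e₃ (toℕ x)) (col-at L x)
    }

  loaded-run : ∀ p {σ} → T (keepsInput p) → Loaded σ → Loaded (run p σ)
  loaded-run p {σ} h = transport
    (frame p (∧-fst h) σ)
    (frame p (∧-fst (∧-snd {keeps 0 p} h)) σ)
    (frame p (∧-fst (∧-snd {keeps 1 p} (∧-snd {keeps 0 p} h))) σ)
    (frame p (∧-snd {keeps 2 p} (∧-snd {keeps 1 p} (∧-snd {keeps 0 p} h))) σ)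

  loaded-loop : ∀ c p {σ} i → T (keepsInput (FOR c < 0 DO p)) → Loaded σ → Loaded (loop c p σ i)
  loaded-loop c p {σ} i h = transport
    (go 0 (∧-fst h))
    (go 1 (∧-fst (∧-snd {keeps 0 q} h)))
    (go 2 (∧-fst (∧-snd {keeps 1 q} (∧-snd {keeps 0 q} h))))
    (go 3 (∧-snd {keeps 2 q} (∧-snd {keeps 1 q} (∧-snd {keeps 0 q} h))))
    where
    q : Code
    q = FOR c < 0 DO p
    go : ∀ a → T (keeps a q) → ∀ x → loop c p σ i a x ≡ σ a x
    go a g = frame-loop c p (∧-snd {not (a ≡ᵇ c)} g) (∧-fst g) σ i

  open _Enumerates_ enum

  w : Weight n
  w = graphWeight G

  edge-γ : ∀ x → γ w (s x) (t x) ≡ 1 + colorCode (color (lookup es x)) + colorCode (color (lookup es x))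
  edge-γ x with lookup es x | Equivalence.to exact (∈-lookup {xs = es} x)
  ... | edge u v red  | _ , h = γ-red G h
  ... | edge u v blue | _ , h = γ-blue G h

  edge-∈E : ∀ x → E G ∋ s x ─ t x
  edge-∈E x = γ-edge G λ e → contradiction (trans (sym (edge-γ x)) e) λ ()

  index-of : ∀ {u v} c → u Fin.< v → E[ G ] c ∋ u ─ v → ∃[ x ] (s x ≡ u × t x ≡ v)
  index-of {u} {v} c u<v h with i ← Equivalence.from (exact {u} {v} {c}) (u<v , h) =
    Any.index i , cong src (sym (lookup-index i)) , cong tgt (sym (lookup-index i))

  edge-index : ∀ {u v} → u Fin.< v → γ w u v ≢ 0 → ∃[ x ] (s x ≡ u × t x ≡ v)
  edge-index {u} {v} u<v e with γ w u v in eq | value w u v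
  ... | _ | none  = contradiction refl e
  ... | _ | red₁  = index-of red u<v (code-one _ (has (Eᵇ G) u v) eq)
  ... | _ | blue₃ = index-of blue u<v (code-three (has (Eᵣ G) u v) _ eq)

  Offsets : State → Set
  Offsets σ = ∀ (u : Fin n) → σ 6 (toℕ u) ≡ toℕ u * n

  unmasked : ∀ {F u v} → γ (mask w F) u v ≢ 0 → γ w u v ≢ 0
  unmasked {F} {u} {v} h with has F u v
  ... | true  = contradiction refl h
  ... | false = h

  Flags : EdgeSet n → (ℕ → ℕ) → Set
  Flags F d = ∀ x → (F ∋ s x ─ t x → 1 ≤ d (toℕ x)) × (¬ F ∋ s x ─ t x → d (toℕ x) ≡ 0)

  Holds : EdgeSet n → (ℕ → ℕ) → Set
  Holds F a = ∀ u v → a (at u v) ≡ γ (mask w F) u v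

  fill-spec : ∀ D M → T (not (D ≡ᵇ 9 + M)) → T (not (D ≡ᵇ 4)) → ∀ F {σ} → Loaded σ → Offsets σ → Flags F (σ D) →
    (∀ x → σ (9 + M) x ≡ 0) → Holds F (run (fill D (9 + M)) σ (9 + M))
  fill-spec D M D≢M D≢4 F {σ} L offsets flags blank rewrite m-at L = result (loop-inductionᶠ {4} {body} {σ} P base step)
    where
    body : Code
    body = fill-body D (9 + M)
    δ : Fin n → Fin n → ℕ
    δ = γ (mask w F)
    P : ℕ → State → Set
    P i τ = (∀ u v → τ (9 + M) (at u v) ≡ 0 ⊎ τ (9 + M) (at u v) ≡ δ u v) ×
            (∀ (x : Fin m) → toℕ x < i → τ (9 + M) (at (s x) (t x)) ≡ δ (s x) (t x) × τ (9 + M) (at (t x) (s x)) ≡ δ (t x) (s x))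
    base : P 0 (loop 4 body σ 0)
    base = (λ u v → inj₁ (blank (at u v))) , λ _ ()
    step : ∀ x → P (toℕ x) (loop 4 body σ (toℕ x)) → P (suc (toℕ x)) (loop 4 body σ (suc (toℕ x)))
    step x (old , done) = decide (T? (has F (s x) (t x)))
      where
      τ : State
      τ = loop 4 body σ (toℕ x)
      Lτ : Loaded τ
      Lτ = loaded-loop 4 body (toℕ x) _ L
      now : τ 4 0 ≡ toℕ x
      now = counter 4 body σ (toℕ x)
      flag-at : τ D (τ 4 0) ≡ σ D (toℕ x)
      flag-at = trans (cong (τ D) now) (frame-loop 4 body {D} (Equivalence.from T-∧ (D≢M , D≢M)) D≢4 σ (toℕ x) (toℕ x))
      s≡ : τ 1 (τ 4 0) ≡ toℕ (s x)
      s≡ = trans (cong (τ 1) now) (src-at Lτ x)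
      t≡ : τ 2 (τ 4 0) ≡ toℕ (t x)
      t≡ = trans (cong (τ 2) now) (tgt-at Lτ x)
      row : ∀ u → τ 6 (toℕ u) ≡ toℕ u * n
      row u = trans (frame-loop 4 body _ _ σ (toℕ x) (toℕ u)) (offsets u)
      code≡ : 1 + τ 3 (τ 4 0) + τ 3 (τ 4 0) ≡ γ w (s x) (t x)
      code≡ = trans (cong (λ c → 1 + c + c) (trans (cong (τ 3) now) (col-at Lτ x))) (sym (edge-γ x))
      st : τ 6 (τ 1 (τ 4 0)) + τ 2 (τ 4 0) ≡ at (s x) (t x)
      st = cong₂ _+_ (trans (cong (τ 6) s≡) (row (s x))) t≡
      ts : τ 6 (τ 2 (τ 4 0)) + τ 1 (τ 4 0) ≡ at (t x) (s x)
      ts = cong₂ _+_ (trans (cong (τ 6) t≡) (row (t x))) s≡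
      decide : Dec (F ∋ s x ─ t x) → P (suc (toℕ x)) (loop 4 body σ (suc (toℕ x)))
      before : ∀ y → toℕ y < suc (toℕ x) → toℕ y < toℕ x ⊎ y ≡ x
      before y y≤x with m≤n⇒m<n∨m≡n (≤-pred y≤x)
      ... | inj₁ y<x = inj₁ y<x
      ... | inj₂ y≡x = inj₂ (toℕ-injective y≡x)
      decide (yes f) = subst (λ ρ → P (suc (toℕ x)) (ρ [ 4 , 0 ↦ suc (toℕ x) ]))
        (sym (when-no (unflagged D) (put-edge (9 + M)) τ (m≤n⇒m∸n≡0 (subst (1 ≤_) (sym flag-at) (proj₁ (flags x) f)))))
        (old , next)
        where
        zero-at : ∀ u v → F ∋ u ─ v → τ (9 + M) (at u v) ≡ δ u v
        zero-at u v f with old u v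
        ... | inj₁ e = trans e (sym (mask-true w F f))
        ... | inj₂ e = e
        next : ∀ y → toℕ y < suc (toℕ x) → τ (9 + M) (at (s y) (t y)) ≡ δ (s y) (t y) × τ (9 + M) (at (t y) (s y)) ≡ δ (t y) (s y)
        next y y≤x with before y y≤x
        ... | inj₁ y<x  = done y y<x
        ... | inj₂ refl = zero-at (s x) (t x) f , zero-at (t x) (s x) (swap-edge F f)
      decide (no ¬f) = subst (λ ρ → P (suc (toℕ x)) (ρ [ 4 , 0 ↦ suc (toℕ x) ]))
        (sym (when-yes (unflagged D) (put-edge (9 + M)) τ (subst (λ d → 1 ∸ d ≢ 0) (sym (trans flag-at (proj₂ (flags x) ¬f))) λ ())))
        ((λ u v → new₂ u v (old u v)) , next)
        where
        i₁ i₂ c : ℕ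
        i₁ = τ 6 (τ 1 (τ 4 0)) + τ 2 (τ 4 0)
        i₂ = τ 6 (τ 2 (τ 4 0)) + τ 1 (τ 4 0)
        c  = 1 + τ 3 (τ 4 0) + τ 3 (τ 4 0)
        τ₁ τ₂ : State
        τ₁ = τ [ 9 + M , i₁ ↦ c ]
        τ₂ = τ₁ [ 9 + M , i₂ ↦ c ]
        c≡ : c ≡ δ (s x) (t x)
        c≡ = trans code≡ (sym (mask-false w F ¬f))
        put : ∀ (ρ : State) i {u v} → i ≡ at u v → c ≡ δ u v → ∀ u′ v′ →
          (ρ [ 9 + M , i ↦ c ]) (9 + M) (at u′ v′) ≡ δ u′ v′ ⊎
          (ρ [ 9 + M , i ↦ c ]) (9 + M) (at u′ v′) ≡ ρ (9 + M) (at u′ v′)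
        put ρ i {u} {v} i≡ c≡ u′ v′ with read-cases ρ (9 + M) i (at u′ v′) c
        ... | inj₂ (_ , e) = inj₂ e
        ... | inj₁ (j , e) with refl , refl ← at-injective {u = u} {v} {u′} {v′} (trans (sym i≡) j) = inj₁ (trans e c≡)
        put₁ : ∀ u v → τ₁ (9 + M) (at u v) ≡ δ u v ⊎ τ₁ (9 + M) (at u v) ≡ τ (9 + M) (at u v)
        put₁ = put τ i₁ st c≡
        put₂ : ∀ u v → τ₂ (9 + M) (at u v) ≡ δ u v ⊎ τ₂ (9 + M) (at u v) ≡ τ₁ (9 + M) (at u v)
        put₂ = put τ₁ i₂ ts (trans c≡ (γ-sym (mask w F) (s x) (t x)))
        stays₂ : ∀ u v → τ₁ (9 + M) (at u v) ≡ δ u v → τ₂ (9 + M) (at u v) ≡ δ u v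
        stays₂ u v e with put₂ u v
        ... | inj₁ e′ = e′
        ... | inj₂ e′ = trans e′ e
        stays : ∀ u v → τ (9 + M) (at u v) ≡ δ u v → τ₂ (9 + M) (at u v) ≡ δ u v
        stays u v e with put₁ u v
        ... | inj₁ e′ = stays₂ u v e′
        ... | inj₂ e′ = stays₂ u v (trans e′ e)
        new₂ : ∀ u v → τ (9 + M) (at u v) ≡ 0 ⊎ τ (9 + M) (at u v) ≡ δ u v → τ₂ (9 + M) (at u v) ≡ 0 ⊎ τ₂ (9 + M) (at u v) ≡ δ u v
        new₂ u v (inj₂ e) = inj₂ (stays u v e)
        new₂ u v (inj₁ z) with put₂ u v | put₁ u v
        ... | inj₁ e | _      = inj₂ e
        ... | inj₂ e | inj₁ d = inj₂ (trans e d)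
        ... | inj₂ e | inj₂ d = inj₁ (trans e (trans d z))
        next : ∀ y → toℕ y < suc (toℕ x) → τ₂ (9 + M) (at (s y) (t y)) ≡ δ (s y) (t y) × τ₂ (9 + M) (at (t y) (s y)) ≡ δ (t y) (s y)
        next y y≤x with before y y≤x
        ... | inj₁ y<x  = stays (s y) (t y) (proj₁ (done y y<x)) , stays (t y) (s y) (proj₂ (done y y<x))
        ... | inj₂ refl =
          stays₂ (s x) (t x) (trans (cong (τ₁ (9 + M)) (sym st)) (trans (read-same τ (9 + M) i₁ c) c≡)) ,
          trans (cong (τ₂ (9 + M)) (sym ts)) (trans (read-same τ₁ (9 + M) i₂ c) (trans c≡ (γ-sym (mask w F) (s x) (t x))))
    result : P m (loop 4 body σ m) → Holds F (loop 4 body σ m (9 + M))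
    result (old , done) u v with old u v
    ... | inj₂ eq = eq
    ... | inj₁ z with δ u v ≟ 0
    ...   | yes e = trans z (sym e)
    ...   | no ¬e with Fin.<-cmp u v
    ...     | tri< u<v _ _ with x , refl , refl ← edge-index u<v (unmasked {F} ¬e) = proj₁ (done x (toℕ<n x))
    ...     | tri≈ _ refl _ = contradiction (γ-irr (mask w F) u) ¬e
    ...     | tri> _ _ v<u with x , refl , refl ← edge-index v<u (unmasked {F} (subst (_≢ 0) (γ-sym (mask w F) u v) ¬e)) = proj₂ (done x (toℕ<n x))

  Counts : EdgeSet n → (ℕ → ℕ) → Set
  Counts F c = ∀ x → (F ∋ s x ─ t x → c (toℕ x) ≡ 0) ×
                     (¬ F ∋ s x ─ t x → c (toℕ x) ≡ length (thirds (mask w F) (s x) (t x)))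

  tally-spec : ∀ D M C → T (not (D ≡ᵇ 9 + C)) → T (not (D ≡ᵇ 4)) → T (not (D ≡ᵇ 5)) → T (not (M ≡ᵇ C)) →
    ∀ F {σ} → Loaded σ → Offsets σ → Flags F (σ D) → Holds F (σ (9 + M)) →
    (∀ x → σ (9 + C) x ≡ 0) → Counts F (run (tally D (9 + M) (9 + C)) σ (9 + C))
  tally-spec D M C D≢C D≢4 D≢5 M≢C F {σ} L offsets flags holds blank rewrite m-at L =
    λ x → proj₁ (loop-inductionᶠ {4} {body} {σ} P base step) x (toℕ<n x)
    where
    inner body : Code
    inner = tally-inner (9 + M) (9 + C)
    body = tally-body D (9 + M) (9 + C)
    δ : Fin n → Fin n → ℕ
    δ = γ (mask w F)
    Good : (ℕ → ℕ) → Fin m → Set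
    Good c x = (F ∋ s x ─ t x → c (toℕ x) ≡ 0) ×
               (¬ F ∋ s x ─ t x → c (toℕ x) ≡ length (thirds (mask w F) (s x) (t x)))
    P : ℕ → State → Set
    P i τ = (∀ x → toℕ x < i → Good (τ (9 + C)) x) × (∀ z → i ≤ z → τ (9 + C) z ≡ 0)
    base : P 0 (loop 4 body σ 0)
    base = (λ _ ()) , λ z _ → blank z
    step : ∀ x → P (toℕ x) (loop 4 body σ (toℕ x)) → P (suc (toℕ x)) (loop 4 body σ (suc (toℕ x)))
    step x (done , todo) = decide (T? (has F (s x) (t x)))
      where
      τ : State
      τ = loop 4 body σ (toℕ x)
      Lτ : Loaded τ
      Lτ = loaded-loop 4 body (toℕ x) _ L
      now : τ 4 0 ≡ toℕ x
      now = counter 4 body σ (toℕ x)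
      flag-at : τ D (τ 4 0) ≡ σ D (toℕ x)
      flag-at = trans (cong (τ D) now) (frame-loop 4 body {D} (Equivalence.from T-∧ (D≢5 , D≢C)) D≢4 σ (toℕ x) (toℕ x))
      advance : ∀ {ρ : State} → (∀ z → z ≢ toℕ x → ρ (9 + C) z ≡ τ (9 + C) z) → Good (ρ (9 + C)) x →
        P (suc (toℕ x)) (ρ [ 4 , 0 ↦ suc (toℕ x) ])
      advance {ρ} same good = new , λ z x<z → trans (same z (>⇒≢ x<z)) (todo z (<⇒≤ x<z))
        where
        new : ∀ y → toℕ y < suc (toℕ x) → Good (ρ (9 + C)) y
        new y y≤x with y Fin.≟ x
        ... | yes refl = good
        ... | no y≢x   = let a , b = done y (≤∧≢⇒< (≤-pred y≤x) ne) in
          (λ f → trans (same (toℕ y) ne) (a f)) , (λ f → trans (same (toℕ y) ne) (b f))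
          where
          ne : toℕ y ≢ toℕ x
          ne = y≢x ∘ toℕ-injective
      four? : ∀ v → Dec (δ (s x) (t x) + δ (t x) v + δ (s x) v ≡ 4)
      four? v = δ (s x) (t x) + δ (t x) v + δ (s x) v ≟ 4
      Q : ℕ → State → Set
      Q i ρ = ρ (9 + C) (toℕ x) ≡ count four? (take i (allFin n)) × (∀ z → z ≢ toℕ x → ρ (9 + C) z ≡ τ (9 + C) z)
      inner-step : ∀ v → Q (toℕ v) (loop 5 inner τ (toℕ v)) → Q (suc (toℕ v)) (loop 5 inner τ (suc (toℕ v)))
      inner-step v (cnt , same) = choose (four? v)
        where
        ρ : State
        ρ = loop 5 inner τ (toℕ v)
        now₄ : ρ 4 0 ≡ toℕ x
        now₄ = trans (frame-loop 5 inner _ _ τ (toℕ v) 0) now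
        now₅ : ρ 5 0 ≡ toℕ v
        now₅ = counter 5 inner τ (toℕ v)
        s≡ : ρ 1 (ρ 4 0) ≡ toℕ (s x)
        s≡ = trans (cong (ρ 1) now₄) (trans (frame-loop 5 inner _ _ τ (toℕ v) (toℕ x)) (src-at Lτ x))
        t≡ : ρ 2 (ρ 4 0) ≡ toℕ (t x)
        t≡ = trans (cong (ρ 2) now₄) (trans (frame-loop 5 inner _ _ τ (toℕ v) (toℕ x)) (tgt-at Lτ x))
        entry : ∀ {i j} a b → i ≡ toℕ a → j ≡ toℕ b → ρ (9 + M) (ρ 6 i + j) ≡ δ a b
        entry a b refl refl = trans
          (cong (λ r → ρ (9 + M) (r + toℕ b)) (trans (frame-loop 5 inner _ _ τ (toℕ v) (toℕ a)) (trans (frame-loop 4 body _ _ σ (toℕ x) (toℕ a)) (offsets a))))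
          (trans (frame-loop 5 inner M≢C _ τ (toℕ v) (at a b)) (trans (frame-loop 4 body M≢C _ σ (toℕ x) (at a b)) (holds a b)))
        total : ⟦ triple (9 + M) ⟧ ρ ≡ δ (s x) (t x) + δ (t x) v + δ (s x) v
        total = cong₂ _+_ (cong₂ _+_ (entry (s x) (t x) s≡ t≡) (entry (t x) v t≡ now₅)) (entry (s x) v s≡ now₅)
        more : take (suc (toℕ v)) (allFin n) ≡ take (toℕ v) (allFin n) ∷ʳ v
        more = take-suc-tabulate id v
        choose : Dec (δ (s x) (t x) + δ (t x) v + δ (s x) v ≡ 4) → Q (suc (toℕ v)) (loop 5 inner τ (suc (toℕ v)))
        choose (yes four) = subst (λ ρ → Q (suc (toℕ v)) (ρ [ 5 , 0 ↦ suc (toℕ v) ]))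
          (sym (when-yes (is-four (triple (9 + M))) (bump (9 + C)) ρ (is-four-yes (trans total four))))
          ( trans (cong (ρ′ (9 + C)) (sym now₄)) (trans (read-same ρ (9 + C) (ρ 4 0) (ρ (9 + C) (ρ 4 0) + 1))
              (trans (cong (λ i → ρ (9 + C) i + 1) now₄) (trans (+-comm (ρ (9 + C) (toℕ x)) 1)
              (trans (cong suc cnt) (sym (trans (cong (count four?) more) (count-∷ʳ-yes four? (take (toℕ v) (allFin n)) four)))))))
          , λ z z≢x → trans (read-other ρ (9 + C) (ρ (9 + C) (ρ 4 0) + 1) (λ e → z≢x (trans (sym e) now₄))) (same z z≢x))
          where
          ρ′ : State
          ρ′ = run (bump (9 + C)) ρ
        choose (no ¬four) = subst (λ ρ → Q (suc (toℕ v)) (ρ [ 5 , 0 ↦ suc (toℕ v) ]))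
          (sym (when-no (is-four (triple (9 + M))) (bump (9 + C)) ρ (is-four-no (⟦ triple (9 + M) ⟧ ρ) (λ e → ¬four (trans (sym total) e)))))
          ( trans cnt (sym (trans (cong (count four?) more) (cong length (filter-∷ʳ-no four? (take (toℕ v) (allFin n)) ¬four))))
          , same)
      decide : Dec (F ∋ s x ─ t x) → P (suc (toℕ x)) (loop 4 body σ (suc (toℕ x)))
      decide (yes f) = subst (λ ρ → P (suc (toℕ x)) (ρ [ 4 , 0 ↦ suc (toℕ x) ]))
        (sym (when-no (unflagged D) (FOR 5 < 0 DO inner) τ (m≤n⇒m∸n≡0 (subst (1 ≤_) (sym flag-at) (proj₁ (flags x) f)))))
        (advance {τ} (λ _ _ → refl) ((λ _ → todo (toℕ x) ≤-refl) , λ ¬f → contradiction f ¬f))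
      decide (no ¬f) = subst (λ ρ → P (suc (toℕ x)) (ρ [ 4 , 0 ↦ suc (toℕ x) ]))
        (sym (trans (when-yes (unflagged D) (FOR 5 < 0 DO inner) τ (subst (λ d → 1 ∸ d ≢ 0) (sym (trans flag-at (proj₂ (flags x) ¬f))) λ ()))
          (cong (loop 5 inner τ) (n-at Lτ))))
        (advance {loop 5 inner τ n} (proj₂ end) ((λ f → contradiction f ¬f) ,
          λ _ → trans (proj₁ end) (cong (λ vs → count four? vs) (take-all n (allFin n) (≤-reflexive (length-tabulate id))))))
        where
        end : Q n (loop 5 inner τ n)
        end = loop-inductionᶠ {5} {inner} {τ} Q (todo (toℕ x) ≤-refl , λ _ _ → refl) inner-step

  open Forced w k

  maximise-spec : ∀ {σ X} → Loaded σ → (∀ (x : Fin m) → σ 14 (toℕ x) ≤ X) → σ 15 0 ≡ 0 →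
    (∀ (x : Fin m) → σ 14 (toℕ x) ≤ run maximise σ 15 0) × run maximise σ 15 0 ≤ X
  maximise-spec {σ} {X} L below blank rewrite m-at L =
    let a , b = loop-inductionᶠ {4} {maximise-body} {σ} P ((λ _ ()) , subst (_≤ X) (sym blank) z≤n) step
    in (λ x → a x (toℕ<n x)) , b
    where
    P : ℕ → State → Set
    P i τ = (∀ (x : Fin m) → toℕ x < i → σ 14 (toℕ x) ≤ τ 15 0) × τ 15 0 ≤ X
    step : ∀ x → P (toℕ x) (loop 4 maximise-body σ (toℕ x)) → P (suc (toℕ x)) (loop 4 maximise-body σ (suc (toℕ x)))
    step x (old , τ≤X) = subst (P′ ∘ (λ c → c + (τ 15 0 ∸ c))) (sym now) (new , bounded)
      where
      τ : State
      τ = loop 4 maximise-body σ (toℕ x)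
      c : ℕ
      c = σ 14 (toℕ x)
      P′ : ℕ → Set
      P′ b = (∀ (y : Fin m) → toℕ y < suc (toℕ x) → σ 14 (toℕ y) ≤ b) × b ≤ X
      now : τ 14 (τ 4 0) ≡ c
      now = trans (cong (τ 14) (counter 4 maximise-body σ (toℕ x))) (frame-loop 4 maximise-body _ _ σ (toℕ x) (toℕ x))
      new : ∀ (y : Fin m) → toℕ y < suc (toℕ x) → σ 14 (toℕ y) ≤ c + (τ 15 0 ∸ c)
      new y y≤x with m≤n⇒m<n∨m≡n (≤-pred y≤x)
      ... | inj₁ y<x = ≤-trans (old y y<x) (m≤n+m∸n (τ 15 0) c)
      ... | inj₂ y≡x = subst (λ z → σ 14 z ≤ c + (τ 15 0 ∸ c)) (sym y≡x) (m≤m+n c (τ 15 0 ∸ c))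
      bounded : c + (τ 15 0 ∸ c) ≤ X
      bounded with ≤-total (τ 15 0) c
      ... | inj₁ B≤c = subst (λ z → c + z ≤ X) (sym (m≤n⇒m∸n≡0 B≤c)) (subst (_≤ X) (sym (+-identityʳ c)) (below x))
      ... | inj₂ c≤B = subst (_≤ X) (sym (m+[n∸m]≡n c≤B)) τ≤X

  same-ends : ∀ {e e′} → e ∈ es → e′ ∈ es → src e ≡ src e′ → tgt e ≡ tgt e′ → e ≡ e′
  same-ends {edge u v red}  {edge _ _ red}  i j refl refl = refl
  same-ends {edge u v blue} {edge _ _ blue} i j refl refl = refl
  same-ends {edge u v red}  {edge _ _ blue} i j refl refl =
    contradiction (proj₂ (Equivalence.to exact j)) (disjoint G u v (proj₂ (Equivalence.to exact i)))
  same-ends {edge u v blue} {edge _ _ red}  i j refl refl =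
    contradiction (proj₂ (Equivalence.to exact i)) (disjoint G u v (proj₂ (Equivalence.to exact j)))

  listed : ∀ {u v} → u Fin.< v → E G ∋ u ─ v → ∃[ c ] edge u v c ∈ es
  listed {u} {v} u<v h with Equivalence.to (T-∨ {has (Eᵣ G) u v}) h
  ... | inj₁ r = red , Equivalence.from exact (u<v , r)
  ... | inj₂ b = blue , Equivalence.from exact (u<v , b)

  module _ (F : EdgeSet n) where

    in? : ∀ e → Dec (F ∋ src e ─ tgt e)
    in? e = T? (has F (src e) (tgt e))

    count-edges : F ⊆ᴱ E G → count in? es ≡ card F
    count-edges F⊆E = ≤-antisym
      (inject (λ e q → e ∈ es × (src e , tgt e) ≡ q) (filter in? es) (pairs F) (Unique.filter⁺ in? unique) to
        (λ { (i , refl) (j , e) → same-ends i j (cong proj₁ (sym e)) (cong proj₂ (sym e)) }))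
      (inject (λ q e → q ≡ (src e , tgt e)) (pairs F) (filter in? es) (pairs-unique F) from
        (λ { refl refl → refl }))
      where
      to : ∀ {e} → e ∈ filter in? es → ∃[ q ] (q ∈ pairs F × e ∈ es × (src e , tgt e) ≡ q)
      to {e} i = let j , f = ∈-filter⁻ in? {xs = es} i in
        (src e , tgt e) , ∈-pairs⁺ F (proj₁ (Equivalence.to exact j)) f , j , refl
      from : ∀ {q} → q ∈ pairs F → ∃[ e ] (e ∈ filter in? es × q ≡ (src e , tgt e))
      from {u , v} i = let u<v , f = ∈-pairs⁻ F i ; c , j = listed u<v (F⊆E u v f) in
        edge u v c , ∈-filter⁺ in? j f , refl

  m≡size : m ≡ card (E G)
  m≡size = trans (sym (cong length (filter-all (in? (E G)) (All.tabulate all))))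
    (count-edges (E G) (λ _ _ h → h))
    where
    all : ∀ {e} → e ∈ es → E G ∋ src e ─ tgt e
    all {edge u v red}  i = Equivalence.from (T-∨ {has (Eᵣ G) u v}) (inj₁ (proj₂ (Equivalence.to exact i)))
    all {edge u v blue} i = Equivalence.from (T-∨ {has (Eᵣ G) u v}) (inj₂ (proj₂ (Equivalence.to exact i)))

  flag-spec : ∀ {σ} → Loaded σ → (∀ x → σ 10 (toℕ x) ≡ length (thirds w (s x) (t x))) →
    (∀ z → σ 11 z ≡ 0) → σ 12 0 ≡ 0 → Flags forced (run flag σ 11) × run flag σ 12 0 ≡ card forced
  flag-spec {σ} L counts blank zero-at rewrite m-at L =
    let a , _ , c = loop-inductionᶠ {4} {flag-body} {σ} P ((λ _ ()) , (λ z _ → blank z) , zero-at) step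
    in (λ x → a x (toℕ<n x)) ,
       trans c (trans (cong (count (in? forced)) (take-all m es ≤-refl))
         (count-edges forced (λ u v f → γ-edge G (proj₁ (forced⁻ f)))))
    where
    Good : (ℕ → ℕ) → Fin m → Set
    Good d x = (forced ∋ s x ─ t x → 1 ≤ d (toℕ x)) × (¬ forced ∋ s x ─ t x → d (toℕ x) ≡ 0)
    P : ℕ → State → Set
    P i τ = (∀ x → toℕ x < i → Good (τ 11) x) × (∀ z → i ≤ z → τ 11 z ≡ 0) × τ 12 0 ≡ count (in? forced) (take i es)
    step : ∀ x → P (toℕ x) (loop 4 flag-body σ (toℕ x)) → P (suc (toℕ x)) (loop 4 flag-body σ (suc (toℕ x)))
    step x (done , todo , sum) = decide (T? (has forced (s x) (t x)))
      where
      τ : State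
      τ = loop 4 flag-body σ (toℕ x)
      now : τ 4 0 ≡ toℕ x
      now = counter 4 flag-body σ (toℕ x)
      c≡ : τ 10 (τ 4 0) ∸ τ 0 2 ≡ length (thirds w (s x) (t x)) ∸ k
      c≡ = cong₂ _∸_ (trans (cong (τ 10) now) (trans (frame-loop 4 flag-body _ _ σ (toℕ x) (toℕ x)) (counts x)))
        (trans (frame-loop 4 flag-body _ _ σ (toℕ x) 2) (k-at L))
      before : ∀ {d} (same : ∀ z → z ≢ toℕ x → d z ≡ τ 11 z) → Good d x → ∀ y → toℕ y < suc (toℕ x) → Good d y
      before {d} same good y y≤x with y Fin.≟ x
      ... | yes refl = good
      ... | no y≢x   = let a , b = done y (≤∧≢⇒< (≤-pred y≤x) ne) in
        (λ f → subst (1 ≤_) (sym (same (toℕ y) ne)) (a f)) , (λ f → trans (same (toℕ y) ne) (b f))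
        where
        ne : toℕ y ≢ toℕ x
        ne = y≢x ∘ toℕ-injective
      decide : Dec (forced ∋ s x ─ t x) → P (suc (toℕ x)) (loop 4 flag-body σ (suc (toℕ x)))
      decide (yes f) = subst (λ ρ → P (suc (toℕ x)) (ρ [ 4 , 0 ↦ suc (toℕ x) ]))
        (sym (when-yes (10 [ here₄ ] ⊖ 0 [ lit 2 ]) raise τ (λ e → m>n⇒m∸n≢0 (proj₂ (forced⁻ f)) (trans (sym c≡) e))))
        ( before same ((λ _ → subst (1 ≤_) (sym raised) ≤-refl) , λ ¬f → contradiction f ¬f)
        , (λ z x<z → trans (same z (>⇒≢ x<z)) (todo z (<⇒≤ x<z)))
        , trans (+-comm (τ 12 0) 1) (trans (cong suc sum) (sym (trans (cong (count (in? forced)) (take-suc es x)) (count-∷ʳ-yes (in? forced) (take (toℕ x) es) f)))))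
        where
        same : ∀ z → z ≢ toℕ x → (τ [ 11 , τ 4 0 ↦ 1 ]) 11 z ≡ τ 11 z
        same z z≢x = read-other τ 11 1 (λ e → z≢x (trans (sym e) now))
        raised : (τ [ 11 , τ 4 0 ↦ 1 ]) 11 (toℕ x) ≡ 1
        raised = trans (cong ((τ [ 11 , τ 4 0 ↦ 1 ]) 11) (sym now)) (read-same τ 11 (τ 4 0) 1)
      decide (no ¬f) = subst (λ ρ → P (suc (toℕ x)) (ρ [ 4 , 0 ↦ suc (toℕ x) ]))
        (sym (when-no (10 [ here₄ ] ⊖ 0 [ lit 2 ]) raise τ (trans c≡ (m≤n⇒m∸n≡0 (≮⇒≥ λ l →
          ¬f (forced⁺ ((λ e → contradiction (trans (sym (edge-γ x)) e) λ ()) , l)))))))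
        ( before {τ 11} (λ _ _ → refl) ((λ f → contradiction f ¬f) , λ _ → todo (toℕ x) ≤-refl)
        , (λ z x<z → todo z (<⇒≤ x<z))
        , trans sum (sym (trans (cong (count (in? forced)) (take-suc es x)) (cong length (filter-∷ʳ-no (in? forced) (take (toℕ x) es) ¬f)))))

  Marked : (Fin m → Set) → (ℕ → ℕ) → Set
  Marked Hit a = (∀ v → a (toℕ v) ≡ 0 ⊎ (a (toℕ v) ≡ 1 × ∃[ x ] (Hit x × (v ≡ s x ⊎ v ≡ t x)))) ×
                 (∀ x → Hit x → a (toℕ (s x)) ≡ 1 × a (toℕ (t x)) ≡ 1)

  mark-spec : ∀ e X (Hit : Fin m → Set) {σ} → (∀ x → Dec (Hit x)) → Loaded σ → (∀ z → σ (9 + X) z ≡ 0) →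
    (∀ (x : Fin m) τ → (∀ b → T (keeps b (mark e (9 + X))) → ∀ z → τ b z ≡ σ b z) → τ 4 0 ≡ toℕ x →
      (Hit x → ⟦ e ⟧ τ ≢ 0) × (¬ Hit x → ⟦ e ⟧ τ ≡ 0)) →
    Marked Hit (run (mark e (9 + X)) σ (9 + X))
  mark-spec e X Hit {σ} hit? L blank eval rewrite m-at L =
    let a , b = loop-inductionᶠ {4} {body} {σ} P ((λ v → inj₁ (blank (toℕ v))) , λ _ ()) step
    in a , λ x → b x (toℕ<n x)
    where
    body : Code
    body = mark-body e (9 + X)
    P : ℕ → State → Set
    P i τ = (∀ v → τ (9 + X) (toℕ v) ≡ 0 ⊎ (τ (9 + X) (toℕ v) ≡ 1 × ∃[ x ] (Hit x × (v ≡ s x ⊎ v ≡ t x)))) ×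
            (∀ x → toℕ x < i → Hit x → τ (9 + X) (toℕ (s x)) ≡ 1 × τ (9 + X) (toℕ (t x)) ≡ 1)
    step : ∀ x → P (toℕ x) (loop 4 body σ (toℕ x)) → P (suc (toℕ x)) (loop 4 body σ (suc (toℕ x)))
    step x (old , done) = decide (hit? x)
      where
      τ : State
      τ = loop 4 body σ (toℕ x)
      Lτ : Loaded τ
      Lτ = loaded-loop 4 body (toℕ x) _ L
      now : τ 4 0 ≡ toℕ x
      now = counter 4 body σ (toℕ x)
      value-e : (Hit x → ⟦ e ⟧ τ ≢ 0) × (¬ Hit x → ⟦ e ⟧ τ ≡ 0)
      value-e = eval x τ (λ b h z → frame-loop 4 body (∧-snd {not (b ≡ᵇ 4)} h) (∧-fst h) σ (toℕ x) z) now
      s≡ : τ 1 (τ 4 0) ≡ toℕ (s x)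
      s≡ = trans (cong (τ 1) now) (src-at Lτ x)
      t≡ : τ 2 (τ 4 0) ≡ toℕ (t x)
      t≡ = trans (cong (τ 2) now) (tgt-at Lτ x)
      decide : Dec (Hit x) → P (suc (toℕ x)) (loop 4 body σ (suc (toℕ x)))
      decide (no ¬h) = subst (λ ρ → P (suc (toℕ x)) (ρ [ 4 , 0 ↦ suc (toℕ x) ]))
        (sym (when-no e (put-marks (9 + X)) τ (proj₂ value-e ¬h)))
        (old , next)
        where
        next : ∀ y → toℕ y < suc (toℕ x) → Hit y → τ (9 + X) (toℕ (s y)) ≡ 1 × τ (9 + X) (toℕ (t y)) ≡ 1
        next y y≤x h with m≤n⇒m<n∨m≡n (≤-pred y≤x)
        ... | inj₁ y<x = done y y<x h
        ... | inj₂ y≡x = contradiction (subst Hit (toℕ-injective y≡x) h) ¬h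
      decide (yes h) = subst (λ ρ → P (suc (toℕ x)) (ρ [ 4 , 0 ↦ suc (toℕ x) ]))
        (sym (when-yes e (put-marks (9 + X)) τ (proj₁ value-e h)))
        (new , next)
        where
        τ₁ τ₂ : State
        τ₁ = τ [ 9 + X , τ 1 (τ 4 0) ↦ 1 ]
        τ₂ = τ₁ [ 9 + X , τ 2 (τ 4 0) ↦ 1 ]
        one : ∀ (ρ : State) i z → ρ (9 + X) z ≡ 1 → (ρ [ 9 + X , i ↦ 1 ]) (9 + X) z ≡ 1
        one ρ i z e with read-cases ρ (9 + X) i z 1
        ... | inj₁ (_ , e′) = e′
        ... | inj₂ (_ , e′) = trans e′ e
        new : ∀ v → τ₂ (9 + X) (toℕ v) ≡ 0 ⊎ (τ₂ (9 + X) (toℕ v) ≡ 1 × ∃[ x ] (Hit x × (v ≡ s x ⊎ v ≡ t x)))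
        new v with read-cases τ₁ (9 + X) (τ 2 (τ 4 0)) (toℕ v) 1 | read-cases τ (9 + X) (τ 1 (τ 4 0)) (toℕ v) 1 | old v
        ... | inj₁ (i , e) | _            | _ = inj₂ (e , x , h , inj₂ (toℕ-injective (trans (sym i) t≡)))
        ... | inj₂ (_ , e) | inj₁ (i , d) | _ = inj₂ (trans e d , x , h , inj₁ (toℕ-injective (trans (sym i) s≡)))
        ... | inj₂ (_ , e) | inj₂ (_ , d) | inj₁ z = inj₁ (trans e (trans d z))
        ... | inj₂ (_ , e) | inj₂ (_ , d) | inj₂ (z , r) = inj₂ (trans e (trans d z) , r)
        next : ∀ y → toℕ y < suc (toℕ x) → Hit y → τ₂ (9 + X) (toℕ (s y)) ≡ 1 × τ₂ (9 + X) (toℕ (t y)) ≡ 1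
        next y y≤x h with m≤n⇒m<n∨m≡n (≤-pred y≤x)
        ... | inj₁ y<x = let a , b = done y y<x h in
          one τ₁ (τ 2 (τ 4 0)) (toℕ (s y)) (one τ (τ 1 (τ 4 0)) (toℕ (s y)) a) ,
          one τ₁ (τ 2 (τ 4 0)) (toℕ (t y)) (one τ (τ 1 (τ 4 0)) (toℕ (t y)) b)
        ... | inj₂ y≡x with refl ← toℕ-injective y≡x =
          one τ₁ (τ 2 (τ 4 0)) (toℕ (s x)) (trans (cong (τ₁ (9 + X)) (sym s≡)) (read-same τ (9 + X) (τ 1 (τ 4 0)) 1)) ,
          trans (cong (τ₂ (9 + X)) (sym t≡)) (read-same τ₁ (9 + X) (τ 2 (τ 4 0)) 1)

  module Kept (F : EdgeSet n) (d : ℕ → ℕ) (bit : ∀ (v : Fin n) → d (toℕ v) ≡ 0 ⊎ d (toℕ v) ≡ 1) where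

    open Enumerate d bit public

    Keep : ColoredEdge n → Set
    Keep e = d (toℕ (src e)) ≡ 1 × d (toℕ (tgt e)) ≡ 1 × ¬ F ∋ src e ─ tgt e

    keep? : ∀ e → Dec (Keep e)
    keep? e = (d (toℕ (src e)) ≟ 1) ×-dec (d (toℕ (tgt e)) ≟ 1) ×-dec ¬? (in? F e)

    lift : ColoredEdge total → ColoredEdge n
    lift (edge u v c) = edge (ι u) (ι v) c

  module _ (F : EdgeSet n) {σ : State} (L : Loaded σ) (flags : Flags F (σ 11))
    (bit : ∀ (v : Fin n) → σ 19 (toℕ v) ≡ 0 ⊎ σ 19 (toℕ v) ≡ 1)
    (ranks : ∀ x → x < n → σ 20 x ≡ Sum (σ 19) x)
    (blank : σ 22 0 ≡ 0) where

    open Kept F (σ 19) bit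

    output-spec : ∃[ out ] (map lift out ≡ filter keep? es × Stored (run output σ) 0 out × run output σ 22 0 ≡ length out)
    output-spec rewrite m-at L with loop-inductionᶠ {4} {output-body} {σ} P ([] , refl , _ , blank , z≤n , λ _ _ → refl , refl , refl) step
      where
      P : ℕ → State → Set
      P i τ = ∃[ out ] (map lift out ≡ filter keep? (take i es) × Stored τ 0 out × τ 22 0 ≡ length out ×
        length out ≤ i × (∀ z → i ≤ z → τ 1 z ≡ σ 1 z × τ 2 z ≡ σ 2 z × τ 3 z ≡ σ 3 z))
      step : ∀ x → P (toℕ x) (loop 4 output-body σ (toℕ x)) → P (suc (toℕ x)) (loop 4 output-body σ (suc (toℕ x)))
      step x (out , out≡ , stored , j≡ , j≤ , same) = decide (keep? (lookup es x))
        where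
        τ : State
        τ = loop 4 output-body σ (toℕ x)
        now : τ 4 0 ≡ toℕ x
        now = counter 4 output-body σ (toℕ x)
        s≡ : τ 1 (τ 4 0) ≡ toℕ (s x)
        s≡ = trans (cong (τ 1) now) (trans (proj₁ (same (toℕ x) ≤-refl)) (src-at L x))
        t≡ : τ 2 (τ 4 0) ≡ toℕ (t x)
        t≡ = trans (cong (τ 2) now) (trans (proj₁ (proj₂ (same (toℕ x) ≤-refl))) (tgt-at L x))
        c≡ : τ 3 (τ 4 0) ≡ colorCode (color (lookup es x))
        c≡ = trans (cong (τ 3) now) (trans (proj₂ (proj₂ (same (toℕ x) ≤-refl))) (col-at L x))
        cond≡ : ⟦ both-kept ⟧ τ ≡ σ 19 (toℕ (s x)) + σ 19 (toℕ (t x)) ∸ 1 ∸ σ 11 (toℕ x)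
        cond≡ = cong₂ _∸_ (cong (_∸ 1) (cong₂ _+_
            (trans (cong (τ 19) s≡) (frame-loop 4 output-body _ _ σ (toℕ x) (toℕ (s x))))
            (trans (cong (τ 19) t≡) (frame-loop 4 output-body _ _ σ (toℕ x) (toℕ (t x))))))
          (trans (cong (τ 11) now) (frame-loop 4 output-body _ _ σ (toℕ x) (toℕ x)))
        id≡ : ∀ {i} (v : Fin n) → i ≡ toℕ v → τ 20 i ≡ Sum (σ 19) (toℕ v)
        id≡ v refl = trans (frame-loop 4 output-body _ _ σ (toℕ x) (toℕ v)) (ranks (toℕ v) (toℕ<n v))
        discard : ∀ {a b d} → a ≡ 0 ⊎ a ≡ 1 → b ≡ 0 ⊎ b ≡ 1 → ¬ (a ≡ 1 × b ≡ 1 × d ≡ 0) → a + b ∸ 1 ∸ d ≡ 0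
        discard {d = d} (inj₁ refl) (inj₁ refl) _ = 0∸n≡0 d
        discard {d = d} (inj₁ refl) (inj₂ refl) _ = 0∸n≡0 d
        discard {d = d} (inj₂ refl) (inj₁ refl) _ = 0∸n≡0 d
        discard {d = zero}  (inj₂ refl) (inj₂ refl) h = contradiction (refl , refl , refl) h
        discard {d = suc d} (inj₂ refl) (inj₂ refl) _ = 0∸n≡0 d
        unflag : σ 11 (toℕ x) ≡ 0 → ¬ F ∋ s x ─ t x
        unflag d f = contradiction d (>⇒≢ (proj₁ (flags x) f))
        decide : Dec (Keep (lookup es x)) → P (suc (toℕ x)) (loop 4 output-body σ (suc (toℕ x)))
        decide (no ¬keep) = subst (λ ρ → P (suc (toℕ x)) (ρ [ 4 , 0 ↦ suc (toℕ x) ]))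
          (sym (when-no both-kept emit τ (trans cond≡ (discard (bit (s x)) (bit (t x)) λ (a , b , d) → ¬keep (a , b , unflag d)))))
          ( out , trans out≡ (sym (trans (cong (filter keep?) (take-suc es x)) (filter-∷ʳ-no keep? (take (toℕ x) es) ¬keep)))
          , Stored-counter τ (suc (toℕ x)) 0 out stored , j≡ , m≤n⇒m≤1+n j≤ , λ z x<z → same z (<⇒≤ x<z))
        decide (yes kept@(a , b , ¬f)) = subst (λ ρ → P (suc (toℕ x)) (ρ [ 4 , 0 ↦ suc (toℕ x) ]))
          (sym (when-yes both-kept emit τ (λ e → contradiction (trans (sym (trans cond≡ (cong₂ _∸_ (cong (_∸ 1) (cong₂ _+_ a b)) (proj₂ (flags x) ¬f)))) e) λ ())))
          ( out ∷ʳ e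
          , trans (map-++ lift out (e ∷ [])) (trans (cong₂ (λ es e → es ∷ʳ e) out≡ lift-e)
              (sym (trans (cong (filter keep?) (take-suc es x)) (filter-∷ʳ-yes keep? (take (toℕ x) es) kept))))
          , Stored-counter τ′ (suc (toℕ x)) 0 (out ∷ʳ e) (Stored-∷ʳ τ τ′ 0 out e stored elsewhere stored-e)
          , trans (+-comm (τ 22 0) 1) (trans (cong suc j≡) (trans (+-comm 1 (length out)) (sym (length-++ out))))
          , ≤-trans (≤-reflexive (trans (length-++ out) (+-comm (length out) 1))) (s≤s j≤)
          , λ z x<z → let p , q , r = elsewhere z (λ z≡ → <⇒≱ x<z (subst (_≤ toℕ x) (sym z≡) j≤)) ; p′ , q′ , r′ = same z (<⇒≤ x<z)
                      in trans p p′ , trans q q′ , trans r r′)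
          where
          u v : Fin total
          u = proj₁ (ι-onto (s x) a)
          v = proj₁ (ι-onto (t x) b)
          e : ColoredEdge total
          e = edge u v (color (lookup es x))
          lift-e : lift e ≡ lookup es x
          lift-e = cong₂ (λ a b → edge a b (color (lookup es x))) (proj₂ (ι-onto (s x) a)) (proj₂ (ι-onto (t x) b))
          j : ℕ
          j = τ 22 0
          τ₁ τ₂ τ₃ τ′ : State
          τ₁ = τ [ 1 , j ↦ τ 20 (τ 1 (τ 4 0)) ]
          τ₂ = τ₁ [ 2 , j ↦ τ 20 (τ 2 (τ 4 0)) ]
          τ₃ = τ₂ [ 3 , j ↦ τ 3 (τ 4 0) ]
          τ′ = τ₃ [ 22 , 0 ↦ j + 1 ]
          elsewhere : ∀ z → z ≢ length out → τ′ 1 z ≡ τ 1 z × τ′ 2 z ≡ τ 2 z × τ′ 3 z ≡ τ 3 z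
          elsewhere z z≢ = read-other τ 1 (τ 20 (τ 1 (τ 4 0))) j≢z , read-other τ₁ 2 (τ 20 (τ 2 (τ 4 0))) j≢z , read-other τ₂ 3 (τ 3 (τ 4 0)) j≢z
            where
            j≢z : j ≢ z
            j≢z eq = z≢ (trans (sym eq) j≡)
          stored-e : τ′ 1 (length out) ≡ toℕ u × τ′ 2 (length out) ≡ toℕ v × τ′ 3 (length out) ≡ colorCode (color (lookup es x))
          stored-e = subst (λ i → τ′ 1 i ≡ toℕ u × τ′ 2 i ≡ toℕ v × τ′ 3 i ≡ colorCode (color (lookup es x))) j≡
            ( trans (read-same τ 1 j (τ 20 (τ 1 (τ 4 0)))) (rank-of s≡ (proj₂ (ι-onto (s x) a)))
            , trans (read-same τ₁ 2 j (τ 20 (τ 2 (τ 4 0)))) (rank-of t≡ (proj₂ (ι-onto (t x) b)))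
            , trans (read-same τ₂ 3 j (τ 3 (τ 4 0))) c≡)
            where
            rank-of : ∀ {i u w} → i ≡ toℕ w → ι u ≡ w → τ 20 i ≡ toℕ u
            rank-of {u = u} {w} i≡ ι≡ = trans (id≡ w i≡) (trans (cong (Sum (σ 19) ∘ toℕ) (sym ι≡)) (rank-ι u))
    ... | out , out≡ , stored , j≡ , _ = out , trans out≡ (cong (filter keep?) (take-all m es ≤-refl)) , stored , j≡

  ∅ : EdgeSet n
  ∅ = record { has = λ _ _ → false ; symmetric = λ _ _ → refl ; loopless = λ _ → refl }

  endpoints : ∀ {F u v} → γ (mask w F) u v ≢ 0 →
    ∃[ x ] (¬ F ∋ s x ─ t x × ((u ≡ s x × v ≡ t x) ⊎ (u ≡ t x × v ≡ s x)))
  endpoints {F} {u} {v} uv with Fin.<-cmp u v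
  ... | tri< u<v _ _ with x , refl , refl ← edge-index u<v (unmasked {F} uv) = x , (λ f → uv (mask-true w F f)) , inj₁ (refl , refl)
  ... | tri≈ _ refl _ = contradiction (γ-irr (mask w F) u) uv
  ... | tri> _ _ v<u with x , refl , refl ← edge-index v<u (unmasked {F} (subst (_≢ 0) (γ-sym (mask w F) u v) uv)) =
    x , (λ f → uv (mask-true w F (swap-edge F f))) , inj₂ (refl , refl)

  rest-edge : ∀ x → ¬ forced ∋ s x ─ t x → γ rest (s x) (t x) ≢ 0
  rest-edge x ¬f e = contradiction (trans (sym (edge-γ x)) (trans (sym (mask-false w forced ¬f)) e)) λ ()

  rest⊆E : ∀ {u v} → γ rest u v ≢ 0 → E G ∋ u ─ v
  rest⊆E e = γ-edge G (unmasked {forced} e)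

  μ : ℕ
  μ = k ⊓ Δ G

  flags-cong : ∀ d d′ → (∀ z → d′ z ≡ d z) → Flags forced d → Flags forced d′
  flags-cong d d′ same flags x = (λ f → subst (1 ≤_) (sym (same (toℕ x))) (proj₁ (flags x) f)) ,
                            (λ f → trans (same (toℕ x)) (proj₂ (flags x) f))

  marked-cong : ∀ {Hit} d d′ → (∀ z → d′ z ≡ d z) → Marked Hit d → Marked Hit d′
  marked-cong {Hit} d d′ same (a , b) = (λ v → go v (a v)) ,
    λ x h → trans (same (toℕ (s x))) (proj₁ (b x h)) , trans (same (toℕ (t x))) (proj₂ (b x h))
    where
    go : ∀ v → d (toℕ v) ≡ 0 ⊎ (d (toℕ v) ≡ 1 × ∃[ x ] (Hit x × (v ≡ s x ⊎ v ≡ t x))) →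
      d′ (toℕ v) ≡ 0 ⊎ (d′ (toℕ v) ≡ 1 × ∃[ x ] (Hit x × (v ≡ s x ⊎ v ≡ t x)))
    go v (inj₁ z)       = inj₁ (trans (same (toℕ v)) z)
    go v (inj₂ (o , h)) = inj₂ (trans (same (toℕ v)) o , h)

  marked-bit : ∀ {Hit} d → Marked Hit d → ∀ v → d (toℕ v) ≡ 0 ⊎ d (toℕ v) ≡ 1
  marked-bit d (a , _) v with a v
  ... | inj₁ z       = inj₁ z
  ... | inj₂ (o , _) = inj₂ o

  record Phase₁ (σ : State) : Set where
    field
      loaded  : Loaded σ
      offsets : Offsets σ
      flags   : Flags forced (σ 11)
      deleted : σ 12 0 ≡ card forced
      blank   : ∀ d z → σ (13 + d) z ≡ 0

  phase₁-spec : ∀ {σ} → Loaded σ → BlankWorkspace σ → Phase₁ (run phase₁ σ)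
  phase₁-spec {σ} L blank = record
    { loaded  = loaded-run flag _ Lc
    ; offsets = λ u → trans (frame (fill 8 9 ▸ tally 8 9 10 ▸ flag) {6} _ σa (toℕ u)) (offsets u)
    ; flags   = proj₁ flagged
    ; deleted = proj₂ flagged
    ; blank   = λ d z → trans (frame phase₁ {13 + d} _ σ z) (blank (13 + d) z (m≤m+n 4 (9 + d)))
    }
    where
    σa σb σc : State
    σa = run offsets-code σ
    σb = run (fill 8 9) σa
    σc = run (tally 8 9 10) σb
    La : Loaded σa
    La = loaded-run offsets-code _ L
    Lb : Loaded σb
    Lb = loaded-run (fill 8 9) _ La
    Lc : Loaded σc
    Lc = loaded-run (tally 8 9 10) _ Lb
    offsets : Offsets σa
    offsets u = trans (proj₁ (Prefix.prefix-spec 0 1 _ (0 [ lit 0 ]) {σ} (λ _ → n) (n-at L) (blank 7 0 (m≤m+n 4 3))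
      (λ x τ same _ → trans (same 0 _ 0) (n-at L))) (toℕ u) (toℕ<n u)) (Sum-const n (toℕ u))
    unflagged-all : ∀ d → (∀ z → d z ≡ 0) → Flags ∅ d
    unflagged-all d z x = (λ ()) , λ _ → z (toℕ x)
    holds : Holds ∅ (σb 9)
    holds = fill-spec 8 0 _ _ ∅ La offsets
      (unflagged-all (σa 8) (λ z → trans (frame offsets-code {8} _ σ z) (blank 8 z (m≤m+n 4 4))))
      (λ z → trans (frame offsets-code {9} _ σ z) (blank 9 z (m≤m+n 4 5)))
    counts : Counts ∅ (σc 10)
    counts = tally-spec 8 0 1 _ _ _ _ ∅ Lb
      (λ u → trans (frame (fill 8 9) {6} _ σa (toℕ u)) (offsets u))
      (unflagged-all (σb 8) (λ z → trans (frame (offsets-code ▸ fill 8 9) {8} _ σ z) (blank 8 z (m≤m+n 4 4))))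
      holds
      (λ z → trans (frame (offsets-code ▸ fill 8 9) {10} _ σ z) (blank 10 z (m≤m+n 4 6)))
    flagged : Flags forced (run flag σc 11) × run flag σc 12 0 ≡ card forced
    flagged = flag-spec Lc (λ x → proj₂ (counts x) λ ())
      (λ z → trans (frame (offsets-code ▸ fill 8 9 ▸ tally 8 9 10) {11} _ σ z) (blank 11 z (m≤m+n 4 7)))
      (trans (frame (offsets-code ▸ fill 8 9 ▸ tally 8 9 10) {12} _ σ 0) (blank 12 0 (m≤m+n 4 8)))

  Counted : (ℕ → ℕ) → Fin m → Set
  Counted c x = c (toℕ x) ≢ 0

  record Phase₂ (σ : State) : Set where
    field
      loaded  : Loaded σ
      flags   : Flags forced (σ 11)
      deleted : σ 12 0 ≡ card forced
      blank   : ∀ d z → σ (19 + d) z ≡ 0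
      counts  : ℕ → ℕ
      counted : Counts forced counts
      B       : ℕ
      below   : ∀ (x : Fin m) → counts (toℕ x) ≤ B
      least   : ∀ {b} → (∀ (x : Fin m) → counts (toℕ x) ≤ b) → B ≤ b
      marks   : Marked (Counted counts) (σ 16)
      excess  : σ 18 0 ≡ Sum (σ 16) n ∸ k * (2 + B)

  phase₂-spec : ∀ {σ} → Phase₁ σ → Phase₂ (run phase₂ σ)
  phase₂-spec {σ} first = record
    { loaded  = loaded-run shrink _ Le
    ; flags   = flags-cong (σ 11) (run phase₂ σ 11) (frame phase₂ {11} _ σ) flags
    ; deleted = trans (frame phase₂ {12} _ σ 0) deleted
    ; blank   = λ d z → trans (frame phase₂ {19 + d} _ σ z) (blank (6 + d) z)
    ; counts  = σb 14
    ; counted = counted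
    ; B       = σc 15 0
    ; below   = λ x → proj₁ (maximum (λ x → below-sum x m (toℕ<n x))) x
    ; least   = λ h → proj₂ (maximum h)
    ; marks   = marked-cong (σd 16) (run phase₂ σ 16) (frame (ranks-A ▸ shrink) {16} _ σd) marks
    ; excess  = trans (shrink-spec {σe} (k-at Le)) (cong₂ (λ a b → a ∸ k * (2 + b)) ranked
        (frame (mark (14 [ here₄ ]) 16 ▸ ranks-A) {15} _ σc 0))
    }
    where
    open Phase₁ first
    σa σb σc σd σe : State
    σa = run (fill 11 13) σ
    σb = run (tally 11 13 14) σa
    σc = run maximise σb
    σd = run (mark (14 [ here₄ ]) 16) σc
    σe = run ranks-A σd
    La : Loaded σa
    La = loaded-run (fill 11 13) _ loaded
    Lb : Loaded σb
    Lb = loaded-run (tally 11 13 14) _ La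
    Lc : Loaded σc
    Lc = loaded-run maximise _ Lb
    Ld : Loaded σd
    Ld = loaded-run (mark (14 [ here₄ ]) 16) _ Lc
    Le : Loaded σe
    Le = loaded-run ranks-A _ Ld
    holds : Holds forced (σa 13)
    holds = fill-spec 11 4 _ _ forced loaded offsets flags (blank 0)
    counted : Counts forced (σb 14)
    counted = tally-spec 11 4 5 _ _ _ _ forced La
      (λ u → trans (frame (fill 11 13) {6} _ σ (toℕ u)) (offsets u))
      (flags-cong (σ 11) (σa 11) (frame (fill 11 13) {11} _ σ) flags)
      holds
      (λ z → trans (frame (fill 11 13) {14} _ σ z) (blank 1 z))
    maximum : ∀ {b} → (∀ (x : Fin m) → σb 14 (toℕ x) ≤ b) → (∀ (x : Fin m) → σb 14 (toℕ x) ≤ σc 15 0) × σc 15 0 ≤ b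
    maximum h = maximise-spec Lb h (trans (frame (fill 11 13 ▸ tally 11 13 14) {15} _ σ 0) (blank 2 0))
    below-sum : ∀ x i → toℕ {m} x < i → σb 14 (toℕ x) ≤ Sum (σb 14) i
    below-sum x i x<i = ≤-trans (m≤n+m (σb 14 (toℕ x)) (Sum (σb 14) (toℕ x))) (Sum-mono (σb 14) x<i)
    marks : Marked (Counted (σb 14)) (σd 16)
    marks = mark-spec (14 [ here₄ ]) 7 (Counted (σb 14)) (λ x → ¬? (σb 14 (toℕ x) ≟ 0)) Lc
      (λ z → trans (frame (fill 11 13 ▸ tally 11 13 14 ▸ maximise) {16} _ σ z) (blank 3 z))
      (λ x τ same now → let e = trans (cong (τ 14) now) (trans (same 14 _ (toℕ x)) (frame maximise {14} _ σb (toℕ x))) in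
        (λ h z → h (trans (sym e) z)) , λ ¬h → trans e (decidable-stable (σb 14 (toℕ x) ≟ 0) ¬h))
    ranked : σe 18 0 ≡ Sum (run phase₂ σ 16) n
    ranked = proj₂ (Prefix.prefix-spec 11 12 _ (16 [ here₄ ]) {σd} (run phase₂ σ 16) (n-at Ld)
      (trans (frame (fill 11 13 ▸ tally 11 13 14 ▸ maximise ▸ mark (14 [ here₄ ]) 16) {18} _ σ 0) (blank 5 0))
      (λ x τ same now → trans (cong (τ 16) now) (trans (same 16 _ (toℕ x)) (sym (frame (ranks-A ▸ shrink) {16} _ σd (toℕ x))))))

  module Affects (F : EdgeSet n) {c a : ℕ → ℕ} {B : ℕ} (counted : Counts F c) (below : ∀ (x : Fin m) → c (toℕ x) ≤ B)
    (marks : Marked (Counted c) a) where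

    r : Weight n
    r = mask w F

    module A = Enumerate a (marked-bit a marks)

    nonempty : ∀ {A : Set} {y : A} {xs} → y ∈ xs → length xs ≢ 0
    nonempty {xs = _ ∷ _} _ ()

    inhabited : ∀ {A : Set} (xs : List A) → length xs ≢ 0 → ∃[ y ] y ∈ xs
    inhabited []      h = contradiction refl h
    inhabited (y ∷ _) _ = y , here refl

    thirds≤B : ∀ {u v} → γ r u v ≢ 0 → length (thirds r u v) ≤ B
    thirds≤B {u} {v} e with endpoints {F} e
    ... | x , ¬f , inj₁ (refl , refl) = subst (_≤ B) (proj₂ (counted x) ¬f) (below x)
    ... | x , ¬f , inj₂ (refl , refl) =
      subst (_≤ B) (trans (proj₂ (counted x) ¬f) (cong length (thirds-sym r (s x) (t x)))) (below x)

    affected : ∀ {v} → a (toℕ v) ≡ 1 → Affected r v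
    affected {v} o with proj₁ marks v
    ... | inj₁ z = contradiction (trans (sym z) o) λ ()
    ... | inj₂ (_ , x , h , end) = decide (in? F (lookup es x)) end
      where
      decide : Dec (F ∋ s x ─ t x) → v ≡ s x ⊎ v ≡ t x → Affected r v
      decide (yes f) _ = contradiction (proj₁ (counted x) f) h
      decide (no ¬f) end with y , i ← inhabited (thirds r (s x) (t x)) (λ z → h (trans (proj₂ (counted x) ¬f) z)) | end
      ... | inj₁ refl = t x , y , ∈-thirds⁻ r i
      ... | inj₂ refl = s x , y , P₃-swap r (∈-thirds⁻ r i)

    marked-edge : ∀ {u v y} → γ r u v ≢ 0 → P₃ r u v y → a (toℕ u) ≡ 1
    marked-edge {u} {v} {y} e p with endpoints {F} e
    ... | x , ¬f , inj₁ (refl , refl) = proj₁ (proj₂ marks x λ z →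
      nonempty (∈-thirds⁺ r p) (trans (sym (proj₂ (counted x) ¬f)) z))
    ... | x , ¬f , inj₂ (refl , refl) = proj₂ (proj₂ marks x λ z →
      nonempty (∈-thirds⁺ r (P₃-swap r p)) (trans (sym (proj₂ (counted x) ¬f)) z))

    P₃-edge : ∀ {u v y} → P₃ r u v y → γ r u v ≢ 0 ⊎ γ r u y ≢ 0
    P₃-edge {u} {v} {y} p with γ r u v | γ r u y | γ r v y | value r v y
    P₃-edge p  | suc _ | _     | _ | _     = inj₁ λ ()
    P₃-edge p  | zero  | suc _ | _ | _     = inj₂ λ ()
    P₃-edge () | zero  | zero  | _ | none
    P₃-edge () | zero  | zero  | _ | red₁
    P₃-edge () | zero  | zero  | _ | blue₃

    marked : ∀ {v} → Affected r v → a (toℕ v) ≡ 1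
    marked (u , y , p) with P₃-edge p
    ... | inj₁ e = marked-edge e p
    ... | inj₂ e = marked-edge e (P₃-rotate r (P₃-swap r p))

  affected-few : ∀ {c a B} → (counted : Counts forced c) (below : ∀ (x : Fin m) → c (toℕ x) ≤ B)
    (marks : Marked (Counted c) a) → Solvable w k → Sum a n ≤ k * (2 + B)
  affected-few {c} {a} {B} counted below marks solvable = ≤-trans
    (subst (_≤ (k ∸ card forced) * (2 + B)) A.length-ones
      (few-affected rest (solvable-rest⁺ solvable) thirds≤B A.ones A.ones-unique (affected ∘ A.∈-ones⁻)))
    (*-monoˡ-≤ (2 + B) (m∸n≤m k (card forced)))
    where open Affects forced {c} {a} {B} counted below marks

  open Outcomes G k

  module Written (F : EdgeSet n) (d : ℕ → ℕ) (bit : ∀ (v : Fin n) → d (toℕ v) ≡ 0 ⊎ d (toℕ v) ≡ 1) where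
    open Kept F d bit

    graph′ : TwoColoredGraph
    graph′ = induced G F ι ι-mono ι-injective

    lift-injective : ∀ {e e′} → lift e ≡ lift e′ → e ≡ e′
    lift-injective {edge u v c} {edge u′ v′ c′} eq
      with refl ← ι-injective (cong src eq) | refl ← ι-injective (cong tgt eq) | refl ← cong color eq = refl

    out-enumerates : ∀ {out} → map lift out ≡ filter keep? es → out Enumerates E[_] graph′
    out-enumerates {out} lifted = record
      { unique = Unique.map⁻ (subst Unique (sym lifted) (Unique.filter⁺ keep? unique))
      ; exact  = mk⇔ to from
      }
      where
      to-color : ∀ c {u v} → E[ G ] c ∋ ι u ─ ι v → ¬ F ∋ ι u ─ ι v → E[ graph′ ] c ∋ u ─ v
      to-color red  {u} {v} h ¬f with has (Eᵣ G) (ι u) (ι v) | has F (ι u) (ι v)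
      ... | true | false = _
      ... | true | true  = ¬f _
      to-color blue {u} {v} h ¬f with has (Eᵇ G) (ι u) (ι v) | has F (ι u) (ι v)
      ... | true | false = _
      ... | true | true  = ¬f _
      from-color : ∀ c {u v} → E[ graph′ ] c ∋ u ─ v → E[ G ] c ∋ ι u ─ ι v × ¬ F ∋ ι u ─ ι v
      from-color red  {u} {v} h with has (Eᵣ G) (ι u) (ι v) | has F (ι u) (ι v)
      ... | true | false = _ , λ ()
      from-color blue {u} {v} h with has (Eᵇ G) (ι u) (ι v) | has F (ι u) (ι v)
      ... | true | false = _ , λ ()
      to : ∀ {u v c} → edge u v c ∈ out → u Fin.< v × E[ graph′ ] c ∋ u ─ v
      to {u} {v} {c} i with j , _ , _ , ¬f ← ∈-filter⁻ keep? {xs = es} (subst (lift (edge u v c) ∈_) lifted (∈-map⁺ lift i))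
        with ιu<ιv , h ← Equivalence.to exact j = order-back (Fin.<-cmp u v) , to-color c h ¬f
        where
        order-back : Tri (u Fin.< v) (u ≡ v) (v Fin.< u) → u Fin.< v
        order-back (tri< l _ _)    = l
        order-back (tri≈ _ refl _) = contradiction refl (<⇒≢ ιu<ιv)
        order-back (tri> _ _ l)    = contradiction ιu<ιv (<-asym (ι-mono l))
      from : ∀ {u v c} → u Fin.< v × E[ graph′ ] c ∋ u ─ v → edge u v c ∈ out
      from {u} {v} {c} (u<v , h)
        with g , ¬f ← from-color c h
        with e , i , eq ← ∈-map⁻ lift (subst (lift (edge u v c) ∈_) (sym lifted)
               (∈-filter⁺ keep? (Equivalence.from exact (ι-mono u<v , g)) (ι-one u , ι-one v , ¬f)))
        with refl ← lift-injective eq = i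

  Touches : (ℕ → ℕ) → Fin m → Set
  Touches a x = a (toℕ (s x)) ≡ 1 ⊎ a (toℕ (t x)) ≡ 1

  record Phase₃ (a : ℕ → ℕ) (σ : State) : Set where
    field
      kept  : ℕ → ℕ
      marks : Marked (Touches a) kept
    open Kept forced kept (marked-bit kept marks)
    field
      out      : List (ColoredEdge total)
      lifted   : map lift out ≡ filter keep? es
      stored   : Stored σ 0 out
      n-stored : σ 21 0 ≡ total
      m-stored : σ 22 0 ≡ length out
      k-stored : σ 0 2 ≡ k
      deleted  : σ 12 0 ≡ card forced

  phase₃-spec : ∀ {σ} → Phase₂ σ → Phase₃ (σ 16) (run phase₃ σ)
  phase₃-spec {σ} second = record
    { kept     = σb 19
    ; marks    = marks-K
    ; out      = proj₁ written
    ; lifted   = proj₁ (proj₂ written)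
    ; stored   = proj₁ (proj₂ (proj₂ written))
    ; n-stored = trans (frame output {21} _ σb 0) (proj₂ ranked)
    ; m-stored = proj₂ (proj₂ (proj₂ written))
    ; k-stored = trans (frame phase₃ {0} _ σ 2) (k-at loaded)
    ; deleted  = trans (frame phase₃ {12} _ σ 0) deleted
    }
    where
    open Phase₂ second
    mark-K : Code
    mark-K = mark (16 [ 1 [ here₄ ] ] ⊕ 16 [ 2 [ here₄ ] ]) 19
    σa σb : State
    σa = run mark-K σ
    σb = run ranks-K σa
    La : Loaded σa
    La = loaded-run mark-K _ loaded
    Lb : Loaded σb
    Lb = loaded-run ranks-K _ La
    touches? : ∀ x → Dec (Touches (σ 16) x)
    touches? x = (σ 16 (toℕ (s x)) ≟ 1) ⊎-dec (σ 16 (toℕ (t x)) ≟ 1)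
    zero-bit : ∀ {b} → b ≡ 0 ⊎ b ≡ 1 → b ≢ 1 → b ≡ 0
    zero-bit (inj₁ z) _ = z
    zero-bit (inj₂ o) h = contradiction o h
    positive : ∀ {a b} → a ≡ 1 ⊎ b ≡ 1 → a + b ≢ 0
    positive (inj₁ refl) ()
    positive {zero} (inj₂ refl) ()
    positive {suc _} (inj₂ refl) ()
    marks-K : Marked (Touches (σ 16)) (σb 19)
    marks-K = marked-cong (σa 19) (σb 19) (frame ranks-K {19} _ σa)
      (mark-spec (16 [ 1 [ here₄ ] ] ⊕ 16 [ 2 [ here₄ ] ]) 10 (Touches (σ 16)) touches? loaded (blank 0) λ x τ same now →
        let e = cong₂ _+_
              (trans (cong (τ 16) (trans (cong (τ 1) now) (trans (same 1 _ (toℕ x)) (src-at loaded x)))) (same 16 _ (toℕ (s x))))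
              (trans (cong (τ 16) (trans (cong (τ 2) now) (trans (same 2 _ (toℕ x)) (tgt-at loaded x)))) (same 16 _ (toℕ (t x))))
        in (λ h z → positive h (trans (sym e) z)) ,
           λ ¬h → trans e (cong₂ _+_ (zero-bit (marked-bit (σ 16) marks (s x)) (¬h ∘ inj₁)) (zero-bit (marked-bit (σ 16) marks (t x)) (¬h ∘ inj₂))))
    ranked : (∀ x → x < n → σb 20 x ≡ Sum (σb 19) x) × σb 21 0 ≡ Sum (σb 19) n
    ranked = Prefix.prefix-spec 14 15 _ (19 [ here₄ ]) {σa} (σb 19) (n-at La)
      (trans (frame mark-K {21} _ σ 0) (blank 2 0))
      (λ x τ same now → trans (cong (τ 19) now) (trans (same 19 _ (toℕ x)) (sym (frame ranks-K {19} _ σa (toℕ x)))))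
    open Kept forced (σb 19) (marked-bit (σb 19) marks-K)
    written : ∃[ out ] (map lift out ≡ filter keep? es × Stored (run output σb) 0 out × run output σb 22 0 ≡ length out)
    written = output-spec forced Lb (flags-cong (σ 11) (σb 11) (frame (mark-K ▸ ranks-K) {11} _ σ) flags) (marked-bit (σb 19) marks-K)
      (proj₁ ranked) (trans (frame (mark-K ▸ ranks-K) {22} _ σ 0) (blank 3 0))

  module Result {a : ℕ → ℕ} {ρ : State} (third : Phase₃ a ρ) where
    open Phase₃ third
    open Kept forced kept (marked-bit kept marks)

    open Written forced kept (marked-bit kept marks) public

    accepted : ∃[ σ′ ] (⟨ accept , ρ ⟩⇓ σ′ within 15) × σ′ Encodes ⟨ graph′ , k ∸ card forced ⟩
    accepted = _ , ⇓seq ⇓assign (⇓seq ⇓assign ⇓assign) , record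
      { edges      = out
      ; enumerates = out-enumerates lifted
      ; n-stored   = n-stored
      ; m-stored   = m-stored
      ; k-stored   = cong₂ _∸_ k-stored deleted
      ; src-stored = λ x → proj₁ (Stored-lookup ρ 0 out stored x)
      ; tgt-stored = λ x → proj₁ (proj₂ (Stored-lookup ρ 0 out stored x))
      ; col-stored = λ x → proj₂ (proj₂ (Stored-lookup ρ 0 out stored x))
      }

    module _ {c : ℕ → ℕ} {B : ℕ} (counted : Counts forced c) (below : ∀ (x : Fin m) → c (toℕ x) ≤ B)
      (marks-A : Marked (Counted c) a) (F≤k : card forced ≤ k) where

      open Affects forced {c} {a} {B} counted below marks-A

      closed : ∀ {x y} → Affected rest x → γ rest x y ≢ 0 → (∃[ u ] ι u ≡ x) × (∃[ u ] ι u ≡ y)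
      closed p e with o ← marked p | endpoints {forced} e
      ... | x , _ , inj₁ (refl , refl) = let b , d = proj₂ marks x (inj₁ o) in ι-onto (s x) b , ι-onto (t x) d
      ... | x , _ , inj₂ (refl , refl) = let b , d = proj₂ marks x (inj₂ o) in ι-onto (t x) d , ι-onto (s x) b

      equivalent : YesInstance ⟨ G , k ⟩ ⇔ YesInstance ⟨ graph′ , k ∸ card forced ⟩
      equivalent = mk⇔
        (yes-induced⁺ G forced ι ι-mono ι-injective ∘ solvable-rest⁺ ∘ yes⇒solvable G)
        (solvable⇒yes G ∘ solvable-rest⁻ F≤k ∘ yes-induced⁻ G forced ι ι-mono ι-injective closed)

      total≤ : total ≤ A.total * (1 + Δ G)
      total≤ = subst₂ (λ x y → x ≤ y * (1 + Δ G)) length-ones A.length-ones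
        (neighbourhood-bound G A.ones ones ones-unique (near ∘ ∈-ones⁻))
        where
        near : ∀ {v} → kept (toℕ v) ≡ 1 → ∃[ u ] (u ∈ A.ones × (v ≡ u ⊎ E G ∋ u ─ v))
        near {v} o with proj₁ marks v
        ... | inj₁ z = contradiction (trans (sym z) o) λ ()
        ... | inj₂ (_ , x , inj₁ h , inj₁ refl) = s x , A.∈-ones⁺ h , inj₁ refl
        ... | inj₂ (_ , x , inj₁ h , inj₂ refl) = s x , A.∈-ones⁺ h , inj₂ (edge-∈E x)
        ... | inj₂ (_ , x , inj₂ h , inj₁ refl) = t x , A.∈-ones⁺ h , inj₂ (swap-edge (E G) (edge-∈E x))
        ... | inj₂ (_ , x , inj₂ h , inj₂ refl) = t x , A.∈-ones⁺ h , inj₁ refl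

  X : ℕ
  X = n * m

  module _ (k<m : k < m) where

    1≤m : 1 ≤ m
    1≤m = ≤-trans (s≤s z≤n) k<m

    some : Fin m
    some = fromℕ< 1≤m

    1≤n : 1 ≤ n
    1≤n = ≤-trans (s≤s z≤n) (toℕ<n (s some))

    1≤X : 1 ≤ X
    1≤X = *-mono-≤ 1≤n 1≤m

    module Loops (σ : State) (n-at : σ 0 0 ≡ n) (m-at : σ 0 1 ≡ m) (k-at : σ 0 2 ≡ k) where
      n≤X : n ≤ X
      n≤X = subst (_≤ X) (*-identityʳ n) (*-monoʳ-≤ n 1≤m)
      m≤X : m ≤ X
      m≤X = subst (_≤ X) (*-identityˡ m) (*-monoˡ-≤ m 1≤n)
      open Bounds (σ 0) X (subst (1 ≤_) (sym n-at) 1≤n)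
        (subst (_≤ X) (sym (trans (*-identityʳ (σ 0 0)) n-at)) n≤X)
        (subst (_≤ X) (sym (trans (*-identityʳ (σ 0 1)) m-at)) m≤X)
        (subst (_≤ X) (sym (trans (*-identityʳ (σ 0 2)) k-at)) (≤-trans (<⇒≤ k<m) m≤X))
        (≤-reflexive (trans (cong₂ _*_ m-at n-at) (*-comm m n))) public

    after-phase₂ : ∀ {σ} → card forced ≤ k → Phase₂ σ → Outcome G k kernel₃ σ (2 + (27 + (weight phase₃ * X + 15)))
    after-phase₂ {σ} F≤k second = decide (σ 18 0 ≟ 0)
      where
      open Phase₂ second
      third : Phase₃ (σ 16) (run phase₃ σ)
      third = phase₃-spec second
      thirds≤ : ∀ {u v} → γ rest u v ≢ 0 → length (thirds rest u v) ≤ μ + μ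
      thirds≤ {u} {v} e with ⊓-sel k (Δ G)
      ... | inj₁ eq = subst (λ b → length (thirds rest u v) ≤ b + b) (sym eq) (thirds-rest F≤k e)
      ... | inj₂ eq = subst (λ b → length (thirds rest u v) ≤ b + b) (sym eq) (thirds≤2Δ G rest rest⊆E e)
      counts≤ : ∀ x → counts (toℕ x) ≤ μ + μ
      counts≤ x = bound (in? forced (lookup es x))
        where
        bound : Dec (forced ∋ s x ─ t x) → counts (toℕ x) ≤ μ + μ
        bound (yes f) = subst (_≤ μ + μ) (sym (proj₁ (counted x) f)) z≤n
        bound (no ¬f) = subst (_≤ μ + μ) (sym (proj₂ (counted x) ¬f)) (thirds≤ (rest-edge x ¬f))
      1≤Δ′ : 1 ≤ Δ G
      1≤Δ′ = 1≤Δ G (edge-∈E some)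
      decide : Dec (σ 18 0 ≡ 0) → Outcome G k kernel₃ σ (2 + (27 + (weight phase₃ * X + 15)))
      decide (no ≢0) = outcome-weaken (+-monoʳ-≤ 2 (m≤m+n 27 (weight phase₃ * X + 15)))
        (outcome-then ≢0 (outcome-reject σ λ yes → ≢0 (trans excess (m≤n⇒m∸n≡0 (affected-few {counts} {σ 16} {B} counted below marks (yes⇒solvable G yes))))))
      decide (yes ≡0) = outcome-weaken (+-monoʳ-≤ 2 (m≤n+m (weight phase₃ * X + 15) 27))
        (outcome-else ≡0 (outcome-seq
          (compile-correct phase₃ (Loops.fits₃ σ (n-at loaded) (m-at loaded) (k-at loaded)) 1≤X σ (λ _ → refl))
          (let open Result third ; σ′ , d , enc = accepted in
            graph′ , k ∸ card forced , σ′ , 15 , d , ≤-refl , enc , m∸n≤m k (card forced) ,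
            equivalent {counts} {B} counted below marks F≤k ,
            ≤-trans (total≤ {counts} {B} counted below marks F≤k)
              (≤-trans (*-monoˡ-≤ (1 + Δ G) (m∸n≡0⇒m≤n {Sum (σ 16) n} {k * (2 + B)} (trans (sym excess) ≡0)))
                (size-bound k B (Δ G) μ 1≤Δ′ (least counts≤) (λ 1≤k → ⊓-glb 1≤k 1≤Δ′))))))

    after-phase₁ : ∀ {σ} → Phase₁ σ →
      Outcome G k kernel₂ σ (5 + (27 + (weight phase₂ * X + (2 + (27 + (weight phase₃ * X + 15))))))
    after-phase₁ {σ} first = decide (card forced ≤? k)
      where
      open Phase₁ first
      test : σ 12 0 ∸ σ 0 2 ≡ card forced ∸ k
      test = cong₂ _∸_ deleted (k-at loaded)
      decide : Dec (card forced ≤ k) →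
        Outcome G k kernel₂ σ (5 + (27 + (weight phase₂ * X + (2 + (27 + (weight phase₃ * X + 15))))))
      decide (no F≰k) = outcome-weaken (+-monoʳ-≤ 5 (m≤m+n 27 _))
        (outcome-then (λ z → F≰k (m∸n≡0⇒m≤n (trans (sym test) z)))
          (outcome-reject σ λ yes → let S , S≤k , free = yes⇒solvable G yes in F≰k (forced≤ S S≤k free)))
      decide (yes F≤k) = outcome-weaken (+-monoʳ-≤ 5 (m≤n+m _ 27))
        (outcome-else (trans test (m≤n⇒m∸n≡0 F≤k)) (outcome-seq
          (compile-correct phase₂ (Loops.fits₂ σ (n-at loaded) (m-at loaded) (k-at loaded)) 1≤X σ (λ _ → refl))
          (after-phase₂ F≤k (phase₂-spec first))))

  time-sum : ∀ x y z X → 5 + (x * X + (5 + (27 + (y * X + (2 + (27 + (z * X + 15))))))) ≡ 81 + (x + y + z) * X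
  time-sum = solve-∀

  kernel-outcome : ∀ {σ} → Loaded σ → BlankWorkspace σ →
    Outcome G k kernel σ ((81 + (weight phase₁ + weight phase₂ + weight phase₃)) * (1 + order G * size G))
  kernel-outcome {σ} L blank = outcome-weaken enough (decide (k <? m))
    where
    W : ℕ
    W = weight phase₁ + weight phase₂ + weight phase₃
    enough : 81 + W * X ≤ (81 + W) * (1 + order G * size G)
    enough = subst (λ y → 81 + W * X ≤ (81 + W) * (1 + n * y)) m≡size
      (subst (81 + W * X ≤_) (sym (*-suc (81 + W) X))
        (+-mono-≤ (m≤m+n 81 W) (*-monoˡ-≤ X (m≤n+m W 81))))
    decide : Dec (k < m) → Outcome G k kernel σ (81 + W * X)
    decide (yes k<m) = outcome-weaken (≤-reflexive (time-sum (weight phase₁) (weight phase₂) (weight phase₃) X))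
      (outcome-then (λ z → <⇒≱ k<m (m∸n≡0⇒m≤n (trans (sym (cong₂ _∸_ (m-at L) (k-at L))) z))) (outcome-seq
        (compile-correct phase₁ (Loops.fits₁ k<m σ (n-at L) (m-at L) (k-at L)) (1≤X k<m) σ (λ _ → refl))
        (after-phase₁ k<m (phase₁-spec L blank))))
    decide (no k≮m) = outcome-weaken (≤-trans (≤ᵇ⇒≤ 11 81 _) (m≤m+n 81 (W * X)))
      (outcome-else (trans (cong₂ _∸_ (m-at L) (k-at L)) (m≤n⇒m∸n≡0 (≮⇒≥ k≮m)))
        (outcome-clear (k-at L) (subst (_≤ k) m≡size (≮⇒≥ k≮m))))

theorem5 :
    ∃[ kernel ] ∃[ a ] ∃[ b ]
      ((G : TwoColoredGraph) (k : ℕ) (σ : State) →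
       σ Encodes ⟨ G , k ⟩ → BlankWorkspace σ →
       ∃[ G′ ] ∃[ k′ ] ∃[ σ′ ] ∃[ t ]
         ( (⟨ kernel , σ ⟩⇓ σ′ within t)
         × (t ≤ a * (1 + order G * size G))
         × (σ′ Encodes ⟨ G′ , k′ ⟩)
         × (k′ ≤ k)
         × (YesInstance ⟨ G , k ⟩ ⇔ YesInstance ⟨ G′ , k′ ⟩)
         × (order G′ ≤ b * (1 + k * Δ G * (k ⊓ Δ G)))))
theorem5 = kernel , 81 + (weight phase₁ + weight phase₂ + weight phase₃) , 8 , λ G k σ enc blank →
  let open _Encodes_ enc in
  Verified.kernel-outcome G k edges enumerates (record
    { n-at = n-stored ; m-at = m-stored ; k-at = k-stored
    ; src-at = src-stored ; tgt-at = tgt-stored ; col-at = col-stored }) blank
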